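{- Let $Y$ be a walk regular graph and let $X=Y^f$ be an abelian 2ev-cover of $Y$. Then $X$ is walk regular.
   Context: All graphs are finite, simple and undirected; the base graph $Y=(V,E)$ is connected. Covers: let $G$ be a permutation group on $R=\{1,\dots,r\}$. A symmetric arc function is a function $f:V\times V\to G\cup\{0\}$ such that $f(u,v)=0$ if and only if $\{u,v\}\notin E$, and $f(u,v)=f(v,u)^{ -1}$ whenever $f(u,v)\in G$. The cover $Y^f$ (of index $r$, or $r$-fold) is the graph with vertex set $V\times R$ in which $(v,j)$ is adjacent to $(u,k)$ exactly when $v$ is adjacent to $u$ in $Y$ and $f(u,v)j=k$. The function $f$ is normalized if $f(u,v)=\mathrm{id}$ for all edges $\{u,v\}$ of some spanning tree of $Y$. Denote by $\langle f\rangle$ the subgroup of $\mathrm{Sym}(r)$ generated by the (non-zero) values of $f$. Standing assumptions: $f$ is normalized and $\langle f\rangle$ acts regularly (i.e. simply transitively) on $\{1,\dots,r\}$. The cover is called abelian if $\langle f\rangle$ is an abelian group. Two-eigenvalue cover (2ev-cover): $\mathrm{Spec}(A)$ denotes the spectrum of $A$ as a multiset, and $A(\cdot)$ the adjacency matrix. One has $\mathrm{Spec}(A(Y))\subseteq\mathrm{Spec}(A(Y^f))$ as multisets, and $Y^f$ is a 2ev-cover of $Y$ if the multiset difference $\mathrm{Spec}(A(Y^f))\setminus\mathrm{Spec}(A(Y))$ has exactly two distinct elements. A graph with adjacency matrix $A$ is walk regular if $A^k$ has constant diagonal for every positive integer $k$. -}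

module Defs where

open import Algebra.Apartness.Bundles using (HeytingField)
open import Algebra.Bundles using (CommutativeRing; Semiring)
import Algebra.Definitions.RawSemiring as RawSemiringDefinitions
open import Data.Bool.Base using (if_then_else_)
open import Data.Fin.Base using (Fin; zero; suc; toℕ; fromℕ; inject₁; punchIn; remQuot)
open import Data.Fin.Permutation using (Permutation′; _⟨$⟩ʳ_; _≈_; id; flip; _∘ₚ_; inverseʳ)
open import Data.Fin.Properties using (_≟_)
import Data.Integer.Properties as ℤ
open import Data.List.Base using (List; _++_; foldr; map)
open import Data.List.Relation.Unary.All using (All)
import Data.List.Membership.Setoid as Membership
import Data.List.Relation.Binary.Permutation.Setoid as SetoidPermutation
open import Data.Maybe.Base using (Maybe; just; nothing)
open import Data.Maybe.Relation.Unary.Any using (Any; just; dec)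
open import Data.Nat.Base as ℕ using (ℕ; zero; suc)
open import Data.Product.Base using (∃-syntax; _×_; _,_; proj₁; proj₂)
open import Data.Sum.Base using (_⊎_)
open import Function.Bundles using (_⇔_)
open import Function.Definitions using (Injective)
open import Level using (Level; 0ℓ; _⊔_) renaming (suc to lsuc)
open import Relation.Binary.Construct.Closure.ReflexiveTransitive using (Star)
open import Relation.Binary.Core using (Rel)
open import Relation.Binary.Definitions using (Decidable; Symmetric)
open import Relation.Binary.PropositionalEquality.Core using (_≡_; refl; sym; trans; cong; subst)
open import Relation.Binary.Structures using (IsStrictPartialOrder)
open import Relation.Nullary using (¬_; does)
open import Relation.Nullary.Decidable using (_×-dec_)
open import Relation.Unary using (Pred; _∈_)

------------------------------------------------------------------------
-- Graphs

record Graph (n : ℕ) : Set₁ where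
  field
    Adj        : Rel (Fin n) 0ℓ
    adj?       : Decidable Adj
    adj-sym    : Symmetric Adj
    adj-irrefl : ∀ v → ¬ Adj v v

Connected : ∀ {n} → Graph n → Set
Connected Y = ∀ u v → Star (Graph.Adj Y) u v

-- A cycle is given by its 3 + k distinct vertices in cyclic order.
Acyclic : ∀ {n} → Graph n → Set
Acyclic {n} Y = ∀ k (c : Fin (3 ℕ.+ k) → Fin n) →
  Injective _≡_ _≡_ c →
  (∀ (i : Fin (2 ℕ.+ k)) → Adj (c (inject₁ i)) (c (suc i))) →
  ¬ Adj (c (fromℕ (2 ℕ.+ k))) (c zero)
  where open Graph Y

record IsSpanningTree {n} (Y T : Graph n) : Set where
  field
    subgraph  : ∀ {u v} → Graph.Adj T u v → Graph.Adj Y u v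
    connected : Connected T
    acyclic   : Acyclic T

------------------------------------------------------------------------
-- Permutation groups

-- The stdlib composition is diagrammatic: (g ∘ₚ h) i = h (g i).
record PermutationGroup (r : ℕ) : Set₁ where
  field
    Member   : Pred (Permutation′ r) 0ℓ
    resp-≈   : ∀ {g h} → g ≈ h → g ∈ Member → h ∈ Member
    id∈      : id ∈ Member
    ∘ₚ-closed   : ∀ {g h} → g ∈ Member → h ∈ Member → (g ∘ₚ h) ∈ Member
    flip-closed : ∀ {g} → g ∈ Member → flip g ∈ Member

data Generated {r} (S : Pred (Permutation′ r) 0ℓ) : Pred (Permutation′ r) 0ℓ where
  generator : ∀ {g} → g ∈ S → g ∈ Generated S
  identity  : id ∈ Generated S
  compose   : ∀ {g h} → g ∈ Generated S → h ∈ Generated S → (g ∘ₚ h) ∈ Generated S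
  inverse   : ∀ {g} → g ∈ Generated S → flip g ∈ Generated S
  respects  : ∀ {g h} → g ≈ h → g ∈ Generated S → h ∈ Generated S

generatedGroup : ∀ {r} → Pred (Permutation′ r) 0ℓ → PermutationGroup r
generatedGroup S = record
  { Member      = Generated S
  ; resp-≈      = respects
  ; id∈         = identity
  ; ∘ₚ-closed   = compose
  ; flip-closed = inverse
  }

Regular : ∀ {r} → PermutationGroup r → Set
Regular G = ∀ i j →
  (∃[ g ] g ∈ Member × g ⟨$⟩ʳ i ≡ j) ×
  (∀ {g h} → g ∈ Member → h ∈ Member → g ⟨$⟩ʳ i ≡ j → h ⟨$⟩ʳ i ≡ j → g ≈ h)
  where open PermutationGroup G

Abelian : ∀ {r} → PermutationGroup r → Set
Abelian G = ∀ {g h} → g ∈ Member → h ∈ Member → (g ∘ₚ h) ≈ (h ∘ₚ g)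
  where open PermutationGroup G

------------------------------------------------------------------------
-- Covers

-- The adjoined value 0 is 'nothing'.
record SymmetricArcFunction {n r} (Y : Graph n) (G : PermutationGroup r) : Set where
  open Graph Y
  field
    value      : Fin n → Fin n → Maybe (Permutation′ r)
    value∈     : ∀ {u v g} → value u v ≡ just g → g ∈ PermutationGroup.Member G
    value-zero : ∀ u v → value u v ≡ nothing ⇔ (¬ Adj u v)
    value-sym  : ∀ {u v g} → value u v ≡ just g →
                 ∃[ h ] value v u ≡ just h × g ≈ flip h

module _ {n r} {Y : Graph n} {G : PermutationGroup r} (f : SymmetricArcFunction Y G) where
  open Graph Y
  open SymmetricArcFunction f

  ⟨_⟩ : PermutationGroup r
  ⟨_⟩ = generatedGroup (λ g → ∃[ u ] ∃[ v ] value u v ≡ just g)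

  Normalized : Set₁
  Normalized = ∃[ T ] IsSpanningTree Y T ×
    (∀ {u v} → Graph.Adj T u v → Any (_≈ id) (value u v))

  CoverAdj : Rel (Fin n × Fin r) 0ℓ
  CoverAdj (v , j) (u , k) = Adj v u × Any (λ g → g ⟨$⟩ʳ j ≡ k) (value u v)

  private
    value-flip : ∀ {u v j k} → Any (λ g → g ⟨$⟩ʳ j ≡ k) (value u v) →
                 Any (λ g → g ⟨$⟩ʳ k ≡ j) (value v u)
    value-flip {u} {v} {j} {k} p with value u v in eq
    value-flip {u} {v} {j} {k} (just {g} gj≡k) | .(just g) with value-sym eq
    ... | h , eq′ , g≈h⁻¹ = subst (Any (λ g → g ⟨$⟩ʳ k ≡ j)) (sym eq′)
      (just (trans (cong (h ⟨$⟩ʳ_) (trans (sym gj≡k) (g≈h⁻¹ j))) (inverseʳ h)))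

  -- Vertices are identified with pairs through 'remQuot r', a bijection
  -- from Fin (n * r) to Fin n × Fin r with inverse 'combine'.
  cover : Graph (n ℕ.* r)
  cover = record
    { Adj        = λ x y → CoverAdj (remQuot r x) (remQuot r y)
    ; adj?       = λ x y → adj? (proj₁ (remQuot r x)) (proj₁ (remQuot r y)) ×-dec
                           dec (λ g → g ⟨$⟩ʳ proj₂ (remQuot {n} r x) ≟ proj₂ (remQuot {n} r y)) _
    ; adj-sym    = λ (a , p) → adj-sym a , value-flip p
    ; adj-irrefl = λ x (a , _) → adj-irrefl _ a
    }

------------------------------------------------------------------------
-- Matrices

module Matrices {c ℓ} (R : CommutativeRing c ℓ) where
  open CommutativeRing R
    using (Carrier; 0#; 1#; _*_; _-_; -_; semiring)
  open RawSemiringDefinitions (Semiring.rawSemiring semiring) using (sum; _^_)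

  Matrix : ℕ → Set c
  Matrix n = Fin n → Fin n → Carrier

  I : ∀ {n} → Matrix n
  I i j = if does (i ≟ j) then 1# else 0#

  _·_ : ∀ {n} → Matrix n → Matrix n → Matrix n
  (A · B) i j = sum (λ k → A i k * B k j)

  power : ∀ {n} → Matrix n → ℕ → Matrix n
  power A zero    = I
  power A (suc k) = A · power A k

  -- Laplace expansion along the first row.
  det : ∀ {n} → Matrix n → Carrier
  det {zero}  A = 1#
  det {suc n} A = sum λ j →
    ((- 1#) ^ toℕ j) * (A zero j * det (λ i k → A (suc i) (punchIn j k)))

  charPoly : ∀ {n} → Matrix n → Carrier → Carrier
  charPoly A t = det (λ i j → (t * I i j) - A i j)

  adjacency : ∀ {n} → Graph n → Matrix n
  adjacency Y u v = if does (Graph.adj? Y u v) then 1# else 0#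

WalkRegular : ∀ {n} → Graph n → Set
WalkRegular Y = ∀ k → 1 ℕ.≤ k → ∀ u v →
  power (adjacency Y) k u u ≡ power (adjacency Y) k v v
  where open Matrices ℤ.+-*-commutativeRing

------------------------------------------------------------------------
-- Spectra

-- The usual ordered-field axioms in a form that does not presuppose
-- decidability of equality or order, so that classical and constructive
-- real numbers are both instances.
record OrderedField c ℓ₁ ℓ₂ ℓ₃ : Set (lsuc (c ⊔ ℓ₁ ⊔ ℓ₂ ⊔ ℓ₃)) where
  field
    heytingField : HeytingField c ℓ₁ ℓ₂

  open HeytingField heytingField public renaming (_≈_ to _≋_)

  infix 4 _<_
  field
    _<_                  : Rel Carrier ℓ₃
    isStrictPartialOrder : IsStrictPartialOrder _≋_ _<_
    #⇔<⊎>                : ∀ {x y} → x # y ⇔ (x < y ⊎ y < x)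
    0<1                  : 0# < 1#
    +-monoˡ-<            : ∀ z {x y} → x < y → x + z < y + z
    *-pos                : ∀ {x y} → 0# < x → 0# < y → 0# < x * y

  commutativeRing : CommutativeRing c ℓ₁
  commutativeRing = record { isCommutativeRing = isCommutativeRing }

module Spectra {c ℓ₁ ℓ₂ ℓ₃} (K : OrderedField c ℓ₁ ℓ₂ ℓ₃) where
  open OrderedField K using (Carrier; _≋_; _*_; _-_; 1#; commutativeRing)
  open CommutativeRing commutativeRing using (setoid)
  open SetoidPermutation setoid using (_↭_)
  open Membership setoid using () renaming (_∈_ to _∈ₗ_)
  open Matrices commutativeRing

  -- Multisets are lists up to _↭_.  An ordered field is infinite, so
  -- agreement of polynomial functions is agreement of polynomials.
  IsSpectrum : ∀ {n} → Matrix n → List Carrier → Set (c ⊔ ℓ₁)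
  IsSpectrum A s = ∀ t → charPoly A t ≋ foldr _*_ 1# (map (λ θ → t - θ) s)

  ExactlyTwoDistinct : List Carrier → Set (c ⊔ ℓ₁)
  ExactlyTwoDistinct s = ∃[ θ ] ∃[ τ ] ¬ (θ ≋ τ) ×
    θ ∈ₗ s × τ ∈ₗ s × All (λ x → x ≋ θ ⊎ x ≋ τ) s

  -- The multiset difference of the two spectra is 'd'.
  Is2evCover : ∀ {n r} {Y : Graph n} {G : PermutationGroup r} →
               SymmetricArcFunction Y G → Set (c ⊔ ℓ₁)
  Is2evCover {Y = Y} f = ∃[ sX ] ∃[ sY ] ∃[ d ]
    IsSpectrum (adjacency (cover f)) sX ×
    IsSpectrum (adjacency Y) sY ×
    sX ↭ sY ++ d ×
    ExactlyTwoDistinct d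

{-# OPTIONS --safe #-}

-- Let A and B be the adjacency matrices of the base Y and of the r-fold cover X,
-- and let Lᵏ be Aᵏ lifted along the projection of X onto Y.  Each vertex of X has
-- exactly one neighbour in every fibre over a neighbour of its image, so
-- Vₖ = r Bᵏ - Lᵏ satisfies B Vₖ = Vₖ₊₁ and Vᵢ Vⱼ = r Vᵢ₊ⱼ, and
-- tr Vₖ = r (tr Bᵏ - tr Aᵏ) = r Σ_d dᵏ, summed over the new eigenvalues.
-- Hence the symmetric matrix N = V₂ - (θ + τ) V₁ + θτ V₀ has
-- tr N² = r² Σ_d ((d - θ)(d - τ))² = 0, and N vanishes, being real.
-- So the diagonal of Vₖ obeys a two-term recurrence; as V₀ and V₁ have constant
-- diagonal, so has every Vₖ, and then so has r Bᵏ = Vₖ + Lᵏ.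
--
-- That the spectrum, given through the characteristic polynomial p, determines
-- the traces of powers is seen from u_k(t) = tr (Bᵏ adj (t - B)), which satisfies
-- u_{k+1} + p tr Bᵏ = t u_k with deg u_k < deg p.  Since u₀ = p′ depends only on p
-- (it is the limit of divided differences of p), comparing leading coefficients
-- shows that B has the same power traces as the diagonal matrix of its spectrum.

module Submission where

open import Algebra.Apartness.Bundles using (HeytingField)
import Algebra.Apartness.Properties.HeytingCommutativeRing as HeytingProperties
open import Algebra.Bundles using (CommutativeRing; Semiring)
import Algebra.Definitions.RawSemiring as RawSemiringDefinitions
import Algebra.Properties.CommutativeMonoid.Mult as CommutativeMonoidMult
import Algebra.Properties.Group as GroupProperties
import Algebra.Properties.Ring as RingProperties
import Algebra.Properties.Semiring.Mult as SemiringMult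
import Algebra.Properties.Semiring.Sum as SemiringSum
import Algebra.Solver.Ring.NaturalCoefficients.Default as SemiringSolver
open import Data.Bool.Base using (if_then_else_; true; false)
open import Data.Empty using (⊥-elim)
open import Data.Fin.Base using (Fin; zero; suc; toℕ; inject₁; punchIn; remQuot; _↑ˡ_; _↑ʳ_)
open import Data.Fin.Permutation using (_⟨$⟩ʳ_)
open import Data.Fin.Properties using (_≟_; toℕ-inject₁; remQuot-combine; splitAt-↑ʳ)
import Data.Integer.Base as ℤ
import Data.Integer.Properties as ℤₚ
open import Data.List.Base using (List; []; _∷_; _++_; foldr; map; length; lookup)
import Data.List.Relation.Binary.Permutation.Setoid.Properties as PermutationProperties
open import Data.List.Relation.Unary.All using (All; []; _∷_)
open import Data.Maybe.Base using (just; nothing)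
open import Data.Maybe.Relation.Unary.Any using (dec)
open import Data.Nat.Base as ℕ using (ℕ; zero; suc; z≤n; s≤s)
import Data.Nat.Properties as ℕₚ
open import Data.Product.Base using (Σ; ∃; _×_; _,_; proj₁; proj₂; map₁)
open import Data.Sum.Base using (_⊎_; inj₁; inj₂)
open import Data.Vec.Functional using (Vector; tail)
open import Function.Base using (_∘_)
open import Function.Bundles using (Equivalence)
open import Level using (Level; _⊔_)
open import Relation.Binary.Definitions using (tri<; tri≈; tri>)
open import Relation.Binary.PropositionalEquality as ≡ using (_≡_; _≢_)
import Relation.Binary.Reasoning.Setoid as SetoidReasoning
open import Relation.Binary.Structures using (IsStrictPartialOrder)
open import Relation.Nullary using (yes; no; ¬_; does)
open import Relation.Nullary.Decidable using (_×-dec_; dec-true; dec-false)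
open import Defs

-- Row replacement and the index arithmetic of deleted columns.

-- Entries before `i` come from `y` and those after it from `x`: these are the hybrids met when `x`
-- is turned into `y` one entry at a time.
splice : ∀ {a} {A : Set a} {n} → Fin n → A → Vector A n → Vector A n → Vector A n
splice zero    w x y zero    = w
splice zero    w x y (suc k) = x (suc k)
splice (suc i) w x y zero    = y zero
splice (suc i) w x y (suc k) = splice i w (tail x) (tail y) k

replace : ∀ {a} {A : Set a} {n} → Fin n → A → Vector A n → Vector A n
replace i w x = splice i w x x

module _ {a} {A : Set a} where

  splice-self : ∀ {n} i (w : A) (x y : Vector A n) → splice i w x y i ≡ w
  splice-self zero    w x y = ≡.refl
  splice-self (suc i) w x y = splice-self i w (tail x) (tail y)

  replace-other : ∀ {n} i k (w : A) (x : Vector A n) → i ≢ k → replace i w x k ≡ x k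
  replace-other zero    zero    w x i≢k = ⊥-elim (i≢k ≡.refl)
  replace-other zero    (suc k) w x i≢k = ≡.refl
  replace-other (suc i) zero    w x i≢k = ≡.refl
  replace-other (suc i) (suc k) w x i≢k = replace-other i k w (tail x) (i≢k ∘ ≡.cong suc)

-- Applied with `g = punchIn j`, so that the minors of a spliced matrix are again spliced matrices.
splice-columns : ∀ {a b c} {A : Set a} {B : Set b} {C : Set c} {n} (g : C → B)
  i (w : B → A) (x y : Vector (B → A) n) k l →
  splice i w x y k (g l) ≡ splice i (w ∘ g) (λ k → x k ∘ g) (λ k → y k ∘ g) k l
splice-columns g zero    w x y zero    l = ≡.refl
splice-columns g zero    w x y (suc k) l = ≡.refl
splice-columns g (suc i) w x y zero    l = ≡.refl
splice-columns g (suc i) w x y (suc k) l = splice-columns g i w (tail x) (tail y) k l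

-- For `j ≤ k`, deleting column `inject₁ j` and then position `k` removes the same two columns as
-- deleting `suc k` and then position `j`. The three identities locate these two columns and the
-- surviving ones.
punchIn-suc-inject₁ : ∀ {n} (j k : Fin n) → toℕ j ℕ.≤ toℕ k → punchIn (suc k) j ≡ inject₁ j
punchIn-suc-inject₁ zero    k       j≤k       = ≡.refl
punchIn-suc-inject₁ (suc j) (suc k) (s≤s j≤k) = ≡.cong suc (punchIn-suc-inject₁ j k j≤k)

punchIn-inject₁-suc : ∀ {n} (j k : Fin n) → toℕ j ℕ.≤ toℕ k → punchIn (inject₁ j) k ≡ suc k
punchIn-inject₁-suc zero    k       j≤k       = ≡.refl
punchIn-inject₁-suc (suc j) (suc k) (s≤s j≤k) = ≡.cong suc (punchIn-inject₁-suc j k j≤k)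

punchIn-swap : ∀ {n} (j k : Fin (suc n)) (l : Fin n) → toℕ j ℕ.≤ toℕ k →
  punchIn (suc k) (punchIn j l) ≡ punchIn (inject₁ j) (punchIn k l)
punchIn-swap zero    k       l       j≤k       = ≡.refl
punchIn-swap (suc j) (suc k) zero    j≤k       = ≡.refl
punchIn-swap (suc j) (suc k) (suc l) (s≤s j≤k) = ≡.cong suc (punchIn-swap j k l j≤k)

-- Determinants: multilinearity, alternation and cofactors.

module Determinants {c ℓ} (R : CommutativeRing c ℓ) where
  open CommutativeRing R hiding (zero)
  open RawSemiringDefinitions (Semiring.rawSemiring semiring) using (_^_)
  open RingProperties ring using (-1*x≈-x)
  open SemiringSum semiring using (sum; sum-cong-≋; ∑-distrib-+; sum-replicate-zero; *-distribˡ-sum)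
  open Matrices R
  open SemiringSolver commutativeSemiring using (solve; _:=_; _:+_; _:*_)
  open SetoidReasoning setoid

  sum-zero : ∀ {n} {f : Vector Carrier n} → (∀ i → f i ≈ 0#) → sum f ≈ 0#
  sum-zero {n} f≈0 = trans (sum-cong-≋ f≈0) (sum-replicate-zero n)

  sum-I : ∀ {n} (f : Vector Carrier n) k → sum (λ i → f i * I i k) ≈ f k
  sum-I f zero    = trans (+-cong (*-identityʳ _) (sum-zero (λ i → zeroʳ (f (suc i))))) (+-identityʳ _)
  sum-I f (suc k) = trans (+-cong (zeroʳ _) (sum-I (tail f) k)) (+-identityˡ _)

  I-sym : ∀ {n} (i j : Fin n) → I i j ≡ I j i
  I-sym zero    zero    = ≡.refl
  I-sym zero    (suc j) = ≡.refl
  I-sym (suc i) zero    = ≡.refl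
  I-sym (suc i) (suc j) = I-sym i j

  minor : ∀ {n} → Matrix (suc n) → Fin (suc n) → Matrix n
  minor A j i k = A (suc i) (punchIn j k)

  sign : ∀ {n} → Fin n → Carrier
  sign j = (- 1#) ^ toℕ j

  laplaceTerm : ∀ {n} → Matrix (suc n) → Fin (suc n) → Carrier
  laplaceTerm A j = sign j * (A zero j * det (minor A j))

  det-cong : ∀ {n} (A B : Matrix n) → (∀ i j → A i j ≈ B i j) → det A ≈ det B
  det-cong {zero}  A B A≈B = refl
  det-cong {suc n} A B A≈B = sum-cong-≋ {x = laplaceTerm A} {laplaceTerm B} λ j →
    *-congˡ {sign j} (*-cong (A≈B zero j) (det-cong (minor A j) (minor B j) (λ i k → A≈B (suc i) (punchIn j k))))

  minor-splice : ∀ {n} i w (x y : Matrix (suc n)) j →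
    det (minor (splice (suc i) w x y) j) ≈ det (splice i (w ∘ punchIn j) (minor x j) (minor y j))
  minor-splice i w x y j = det-cong _ _ λ k l → reflexive (splice-columns (punchIn j) i w (tail x) (tail y) k l)

  det-row-cong : ∀ {n} i {u v} (x y : Matrix n) → (∀ j → u j ≈ v j) →
    det (splice i u x y) ≈ det (splice i v x y)
  det-row-cong i x y u≈v = det-cong _ _ (splice-cong i x y u≈v)
    where
    splice-cong : ∀ {n m} i {u v : Vector Carrier m} (x y : Vector _ n) → (∀ j → u j ≈ v j) →
      ∀ k l → splice i u x y k l ≈ splice i v x y k l
    splice-cong zero    x y u≈v zero    l = u≈v l
    splice-cong zero    x y u≈v (suc k) l = refl
    splice-cong (suc i) x y u≈v zero    l = refl
    splice-cong (suc i) x y u≈v (suc k) l = splice-cong i (tail x) (tail y) u≈v k l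

  -- Induction on the row: the top row enters each Laplace term linearly, and a lower row enters
  -- only through the minors.
  det-row-+ : ∀ {n} i u v (x y : Matrix n) →
    det (splice i (λ k → u k + v k) x y) ≈ det (splice i u x y) + det (splice i v x y)
  det-row-+ {suc n} i u v x y = begin
    sum (laplaceTerm (splice i (λ k → u k + v k) x y)) ≈⟨ sum-cong-≋ (term-+ i) ⟩
    sum (λ j → U j + V j)                              ≈⟨ ∑-distrib-+ U V ⟩
    sum U + sum V                                      ∎
    where
    U V : Vector Carrier (suc n)
    U = laplaceTerm (splice i u x y)
    V = laplaceTerm (splice i v x y)
    term-+ : ∀ i j → laplaceTerm (splice i (λ k → u k + v k) x y) j ≈
      laplaceTerm (splice i u x y) j + laplaceTerm (splice i v x y) j
    term-+ zero j = solve 4 (λ s a b d → s :* ((a :+ b) :* d) := s :* (a :* d) :+ s :* (b :* d))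
      refl (sign j) (u j) (v j) (det (minor x j))
    term-+ (suc i) j = begin
      _ ≈⟨ *-congˡ (*-congˡ (minor-splice i _ x y j)) ⟩
      _ ≈⟨ *-congˡ (*-congˡ (det-row-+ i (u ∘ punchIn j) (v ∘ punchIn j) (minor x j) (minor y j))) ⟩
      _ ≈⟨ *-congˡ (*-congˡ (+-cong (minor-splice i u x y j) (minor-splice i v x y j))) ⟨
      _ ≈⟨ solve 4 (λ s a d e → s :* (a :* (d :+ e)) := s :* (a :* d) :+ s :* (a :* e)) refl
             (sign j) (y zero j) (det (minor (splice (suc i) u x y) j)) (det (minor (splice (suc i) v x y) j)) ⟩
      _ ∎

  det-row-* : ∀ {n} i a u (x y : Matrix n) →
    det (splice i (λ k → a * u k) x y) ≈ a * det (splice i u x y)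
  det-row-* {suc n} i a u x y = begin
    sum (laplaceTerm (splice i (λ k → a * u k) x y))  ≈⟨ sum-cong-≋ (term-* i) ⟩
    sum (λ j → a * laplaceTerm (splice i u x y) j)    ≈⟨ *-distribˡ-sum a (laplaceTerm (splice i u x y)) ⟨
    a * det (splice i u x y)                          ∎
    where
    term-* : ∀ i j → laplaceTerm (splice i (λ k → a * u k) x y) j ≈ a * laplaceTerm (splice i u x y) j
    term-* zero j = solve 4 (λ s a b d → s :* ((a :* b) :* d) := a :* (s :* (b :* d)))
      refl (sign j) a (u j) (det (minor x j))
    term-* (suc i) j = begin
      _ ≈⟨ *-congˡ (*-congˡ (minor-splice i _ x y j)) ⟩
      _ ≈⟨ *-congˡ (*-congˡ (det-row-* i a (u ∘ punchIn j) (minor x j) (minor y j))) ⟩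
      _ ≈⟨ *-congˡ (*-congˡ (*-congˡ (minor-splice i u x y j))) ⟨
      _ ≈⟨ solve 4 (λ s b a d → s :* (b :* (a :* d)) := a :* (s :* (b :* d))) refl
             (sign j) (y zero j) a (det (minor (splice (suc i) u x y) j)) ⟩
      _ ∎

  -- The index `(j , k)` encodes the ordered pair of distinct columns `j` and `punchIn j k`, and the
  -- hypothesis matches each pair with its transpose. The induction splits off the pairs that
  -- contain column 0.
  sum-pairs-zero : ∀ {m} (F : Fin (suc m) → Fin m → Carrier) →
    (∀ j k → toℕ j ℕ.≤ toℕ k → F (inject₁ j) k + F (suc k) j ≈ 0#) →
    sum (λ j → sum (F j)) ≈ 0#
  sum-pairs-zero {zero}  F pairs = +-identityˡ 0#
  sum-pairs-zero {suc m} F pairs = begin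
    sum (F zero) + sum (λ j → F (suc j) zero + sum (λ k → F (suc j) (suc k)))
      ≈⟨ +-congˡ (∑-distrib-+ (λ j → F (suc j) zero) (λ j → sum (λ k → F (suc j) (suc k)))) ⟩
    sum (F zero) + (sum (λ j → F (suc j) zero) + sum (λ j → sum (λ k → F (suc j) (suc k))))
      ≈⟨ +-assoc _ _ _ ⟨
    sum (F zero) + sum (λ j → F (suc j) zero) + sum (λ j → sum (λ k → F (suc j) (suc k)))
      ≈⟨ +-congʳ (∑-distrib-+ (F zero) (λ j → F (suc j) zero)) ⟨
    sum (λ k → F zero k + F (suc k) zero) + sum (λ j → sum (λ k → F (suc j) (suc k)))
      ≈⟨ +-cong (sum-zero (λ k → pairs zero k z≤n))
                (sum-pairs-zero (λ j k → F (suc j) (suc k)) (λ j k j≤k → pairs (suc j) (suc k) (s≤s j≤k))) ⟩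
    0# + 0# ≈⟨ +-identityˡ 0# ⟩
    0# ∎

  -- Expanding along both rows, the two orders of a pair of columns give the same entries and the
  -- same minor. The signs are opposite, because `sign (suc k)` has one factor `- 1#` more than
  -- `sign k`. Terms cancel in pairs, so nothing is divided by 2.
  det-first-rows-equal : ∀ {n} (A : Matrix (2 ℕ.+ n)) →
    (∀ k → A zero k ≈ A (suc zero) k) → det A ≈ 0#
  det-first-rows-equal {n} A eq = begin
    sum (laplaceTerm A)   ≈⟨ sum-cong-≋ expand ⟩
    sum (λ j → sum (F j)) ≈⟨ sum-pairs-zero F cancel ⟩
    0# ∎
    where
    D : Fin (2 ℕ.+ n) → Fin (suc n) → Carrier
    D j k = det (minor (minor A j) k)
    F : Fin (2 ℕ.+ n) → Fin (suc n) → Carrier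
    F j k = sign j * A zero j * (sign k * (A (suc zero) (punchIn j k) * D j k))
    expand : ∀ j → sign j * (A zero j * det (minor A j)) ≈ sum (F j)
    expand j = trans (sym (*-assoc _ _ _)) (*-distribˡ-sum _ (λ k → sign k * (A (suc zero) (punchIn j k) * D j k)))
    cancel : ∀ j k → toℕ j ℕ.≤ toℕ k → F (inject₁ j) k + F (suc k) j ≈ 0#
    cancel j k j≤k = begin
      F (inject₁ j) k + F (suc k) j
        ≈⟨ +-cong
             (*-cong (*-cong (reflexive (≡.cong ((- 1#) ^_) (toℕ-inject₁ j))) (eq (inject₁ j)))
               (*-congˡ (*-congʳ (reflexive (≡.cong (A (suc zero)) (punchIn-inject₁-suc j k j≤k))))))
             (*-cong (*-congˡ (eq (suc k)))
               (*-congˡ (*-cong (reflexive (≡.cong (A (suc zero)) (punchIn-suc-inject₁ j k j≤k)))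
                 (det-cong _ _ (λ i l → reflexive (≡.cong (A (suc (suc i))) (punchIn-swap j k l j≤k))))))) ⟩
      sign j * A (suc zero) (inject₁ j) * (sign k * (A (suc zero) (suc k) * D (inject₁ j) k)) +
      - 1# * sign k * A (suc zero) (suc k) * (sign j * (A (suc zero) (inject₁ j) * D (inject₁ j) k))
        ≈⟨ +-congˡ (solve 6 (λ m a b s t d → m :* t :* b :* (s :* (a :* d)) := m :* (s :* a :* (t :* (b :* d))))
                     refl (- 1#) (A (suc zero) (inject₁ j)) (A (suc zero) (suc k)) (sign j) (sign k) (D (inject₁ j) k)) ⟩
      _ ≈⟨ +-congˡ (-1*x≈-x _) ⟩
      _ ≈⟨ -‿inverseʳ _ ⟩
      0# ∎

  mutual
    -- Both equal rows survive in every minor along the first row, so induction on the size applies.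
    det-lower-rows-equal : ∀ {n} (A : Matrix (suc n)) {i j} → i ≢ j →
      (∀ k → A (suc i) k ≈ A (suc j) k) → det A ≈ 0#
    det-lower-rows-equal A i≢j eq = sum-zero {f = laplaceTerm A} λ l → trans
      (*-congˡ {sign l} (trans (*-congˡ (det-rows-equal (minor A l) i≢j (λ k → eq (punchIn l k)))) (zeroʳ (A zero l))))
      (zeroʳ _)

    -- For rows 0 and j + 2 with common value a, expand the determinant with
    -- rows 1 and j + 2 both replaced by a + b, where b is row 1.
    det-top-row-equal : ∀ {n} (A : Matrix (suc n)) {j} →
      (∀ k → A zero k ≈ A (suc j) k) → det A ≈ 0#
    det-top-row-equal A {zero} eq = det-first-rows-equal A eq
    det-top-row-equal A {suc j} eq = begin
      det A                            ≈⟨ det-cong A (replace t a A) restore ⟩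
      det (replace t a A)              ≈⟨ +-identityʳ _ ⟨
      det (replace t a A) + 0#         ≈⟨ +-congˡ (det-lower-rows-equal (replace t b A) {zero} {suc j} (λ ()) (λ k → reflexive (≡.sym (self b A k)))) ⟨
      det (replace t a A) + det (replace t b A) ≈⟨ det-row-+ t a b A A ⟨
      det N                            ≈⟨ det-cong N (replace o b N) (λ { zero l → refl ; (suc zero) l → refl ; (suc (suc k)) l → refl }) ⟩
      det (replace o b N)              ≈⟨ +-identityˡ _ ⟨
      0# + det (replace o b N)         ≈⟨ +-congʳ (det-first-rows-equal (replace o a N) (λ k → refl)) ⟨
      det (replace o a N) + det (replace o b N) ≈⟨ det-row-+ o a b N N ⟨
      det (replace o a+b N)            ≈⟨ det-lower-rows-equal (replace o a+b N) {zero} {suc j} (λ ()) (λ k → reflexive (≡.sym (self a+b A k))) ⟩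
      0#                               ∎
      where
      t o : Fin _
      t = suc (suc j)
      o = suc zero
      a b a+b : Vector Carrier _
      a = A zero
      b = A o
      a+b k = a k + b k
      N : Matrix _
      N = replace t a+b A
      self : ∀ w X k → replace t w X t k ≡ w k
      self w X k = ≡.cong (λ v → v k) (splice-self t w X X)
      restore : ∀ k l → A k l ≈ replace t a A k l
      restore k l with t ≟ k
      ... | yes ≡.refl = trans (sym (eq l)) (reflexive (≡.sym (self a A l)))
      ... | no t≢k = reflexive (≡.cong (λ v → v l) (≡.sym (replace-other t k a A t≢k)))

    det-rows-equal : ∀ {n} (A : Matrix n) {i j} → i ≢ j → (∀ k → A i k ≈ A j k) → det A ≈ 0#
    det-rows-equal A {zero}  {zero}  i≢j eq = ⊥-elim (i≢j ≡.refl)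
    det-rows-equal A {zero}  {suc j} i≢j eq = det-top-row-equal A eq
    det-rows-equal A {suc i} {zero}  i≢j eq = det-top-row-equal A (sym ∘ eq)
    det-rows-equal A {suc i} {suc j} i≢j eq = det-lower-rows-equal A (i≢j ∘ ≡.cong suc) eq

  -- A row is a combination of the unit rows `I j`, and linearity is applied term by term. For the
  -- empty combination, homogeneity with scalar 0 gives the value 0.
  linear-expansion : ∀ {n} (φ : Vector Carrier n → Carrier) →
    (∀ {u v} → (∀ k → u k ≈ v k) → φ u ≈ φ v) →
    (∀ u v → φ (λ k → u k + v k) ≈ φ u + φ v) →
    (∀ a u → φ (λ k → a * u k) ≈ a * φ u) →
    ∀ w → φ w ≈ sum (λ j → w j * φ (I j))
  linear-expansion φ φ-cong φ-+ φ-* w =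
    trans (φ-cong (λ k → sym (sum-I w k))) (combination w I)
    where
    combination : ∀ {m} (a : Vector Carrier m) (u : Fin m → Vector Carrier _) →
      φ (λ k → sum (λ i → a i * u i k)) ≈ sum (λ i → a i * φ (u i))
    combination {zero} a u = begin
      φ (λ _ → 0#)      ≈⟨ φ-cong (λ _ → zeroˡ 0#) ⟨
      φ (λ _ → 0# * 0#) ≈⟨ φ-* 0# _ ⟩
      0# * φ (λ _ → 0#) ≈⟨ zeroˡ _ ⟩
      0#                ∎
    combination {suc m} a u = trans (φ-+ _ _) (+-cong (φ-* _ _) (combination (tail a) (tail u)))

  -- The signed minor, encoded by putting a unit row in place of row `i`; multilinearity then
  -- applies without any sign bookkeeping.
  cofactor : ∀ {n} → Matrix n → Matrix n
  cofactor A i j = det (replace i (I j) A)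

  det-replace : ∀ {n} (A : Matrix n) i w → det (replace i w A) ≈ sum (λ j → w j * cofactor A i j)
  det-replace A i = linear-expansion (λ w → det (replace i w A))
    (det-row-cong i A A) (λ u v → det-row-+ i u v A A) (λ a u → det-row-* i a u A A)

  -- The sum is the determinant after row `i` is overwritten by row `l`: this is `A` itself if
  -- `i = l`, and otherwise a matrix with two equal rows.
  cofactor-expansion : ∀ {n} (A : Matrix n) i l →
    sum (λ j → A l j * cofactor A i j) ≈ det A * I i l
  cofactor-expansion A i l with i ≟ l
  ... | yes ≡.refl = begin
    _                       ≈⟨ det-replace A i (A i) ⟨
    det (replace i (A i) A) ≈⟨ det-cong _ _ restore ⟩
    det A                   ≈⟨ *-identityʳ _ ⟨
    det A * 1#              ∎
    where
    restore : ∀ k m → replace i (A i) A k m ≈ A k m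
    restore k m with i ≟ k
    ... | yes ≡.refl = reflexive (≡.cong (λ v → v m) (splice-self i (A i) A A))
    ... | no i≢k = reflexive (≡.cong (λ v → v m) (replace-other i k (A i) A i≢k))
  ... | no i≢l = begin
    _                       ≈⟨ det-replace A i (A l) ⟨
    det (replace i (A l) A) ≈⟨ det-rows-equal _ i≢l (λ k → reflexive (≡.cong (λ v → v k)
      (≡.trans (splice-self i (A l) A A) (≡.sym (replace-other i l (A l) A i≢l))))) ⟩
    0#                      ≈⟨ zeroʳ _ ⟨
    det A * 0#              ∎

  -- The entries of `x` are exchanged for those of `y` one by one, and the changes of `φ` add up.
  telescope : ∀ {n v} {V : Set v} (φ : Vector V n → Carrier) →
    (∀ {x y} → (∀ k → x k ≡ y k) → φ x ≈ φ y) → (x y : Vector V n) (ψ : Fin n → Carrier) →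
    (∀ i → φ (splice i (x i) x y) ≈ φ (splice i (y i) x y) + ψ i) →
    φ x ≈ φ y + sum ψ
  telescope {zero} φ φ-cong x y ψ step = trans (φ-cong (λ ())) (sym (+-identityʳ _))
  telescope {suc n} φ φ-cong x y ψ step = begin
    φ x                          ≈⟨ φ-cong (λ { zero → ≡.refl ; (suc k) → ≡.refl }) ⟩
    φ (splice zero (x zero) x y) ≈⟨ step zero ⟩
    φ (splice zero (y zero) x y) + ψ zero ≈⟨ +-congʳ (φ-cong (λ { zero → ≡.refl ; (suc k) → ≡.refl })) ⟩
    φ′ (tail x) + ψ zero         ≈⟨ +-congʳ (telescope φ′ (λ x≡y → φ-cong (λ { zero → ≡.refl ; (suc k) → x≡y k }))
                                      (tail x) (tail y) (tail ψ) step′) ⟩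
    φ′ (tail y) + sum (tail ψ) + ψ zero ≈⟨ trans (+-assoc _ _ _) (+-cong (φ-cong (λ { zero → ≡.refl ; (suc k) → ≡.refl })) (+-comm _ _)) ⟩
    φ y + sum ψ                  ∎
    where
    -- Entry 0 has already been exchanged; `φ′` sees only the remaining entries.
    cons : Vector _ n → Vector _ (suc n)
    cons z zero    = y zero
    cons z (suc k) = z k
    φ′ : Vector _ n → Carrier
    φ′ z = φ (cons z)
    unfold : ∀ i w → φ′ (splice i w (tail x) (tail y)) ≈ φ (splice (suc i) w x y)
    unfold i w = φ-cong (λ { zero → ≡.refl ; (suc k) → ≡.refl })
    step′ : ∀ i → φ′ (splice i (tail x i) (tail x) (tail y)) ≈ φ′ (splice i (tail y i) (tail x) (tail y)) + ψ (suc i)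
    step′ i = trans (unfold i _) (trans (step (suc i)) (+-congʳ (sym (unfold i _))))

-- Cancellation in ordered fields.

module OrderedFieldProperties {c ℓ₁ ℓ₂ ℓ₃} (K : OrderedField c ℓ₁ ℓ₂ ℓ₃) where
  open OrderedField K
    using (heytingField; _#_; _<_; #⇔<⊎>; 0<1; +-monoˡ-<; #⇒invertible; commutativeRing; isStrictPartialOrder)
  open CommutativeRing commutativeRing hiding (zero)
  open IsStrictPartialOrder isStrictPartialOrder using (<-respˡ-≈; <-respʳ-≈) renaming (trans to <-trans)
  open HeytingProperties (HeytingField.heytingCommutativeRing heytingField) using (x-0≈x)
  open SemiringMult semiring using () renaming (_×_ to _×′_; ×-assoc-* to ×′-assoc-*; ×-congʳ to ×′-congʳ)

  <⇒# : ∀ {x y} → x < y → y # x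
  <⇒# x<y = Equivalence.from #⇔<⊎> (inj₂ x<y)

  x<x+1 : ∀ x → x < x + 1#
  x<x+1 x = <-respˡ-≈ (+-identityˡ x) (<-respʳ-≈ (+-comm 1# x) (+-monoˡ-< x 0<1))

  -- Characteristic zero in order form; it yields the apartness from 0 that is needed to divide by
  -- positive integers.
  0<1+n : ∀ n → 0# < suc n ×′ 1#
  0<1+n zero    = <-respʳ-≈ (sym (+-identityʳ 1#)) 0<1
  0<1+n (suc n) = <-trans (0<1+n n) (<-respʳ-≈ (+-comm _ 1#) (x<x+1 _))

  *-cancelˡ-# : ∀ {x y a b} → x # y → (x - y) * a ≈ (x - y) * b → a ≈ b
  *-cancelˡ-# {x} {y} {a} {b} x#y eq with #⇒invertible x#y
  ... | z , z*[x-y]≈1 , _ = begin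
    a                 ≈⟨ *-identityˡ a ⟨
    1# * a            ≈⟨ *-congʳ z*[x-y]≈1 ⟨
    z * (x - y) * a   ≈⟨ *-assoc _ _ _ ⟩
    z * ((x - y) * a) ≈⟨ *-congˡ eq ⟩
    z * ((x - y) * b) ≈⟨ *-assoc _ _ _ ⟨
    z * (x - y) * b   ≈⟨ *-congʳ z*[x-y]≈1 ⟩
    1# * b            ≈⟨ *-identityˡ b ⟩
    b                 ∎
    where open SetoidReasoning setoid

  *-cancelˡ-#0 : ∀ {x a b} → x # 0# → x * a ≈ x * b → a ≈ b
  *-cancelˡ-#0 {x} x#0 eq = *-cancelˡ-# x#0
    (trans (*-congʳ (x-0≈x x)) (trans eq (*-congʳ (sym (x-0≈x x)))))

  ×-cancelˡ : ∀ n {a b} → suc n ×′ a ≈ suc n ×′ b → a ≈ b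
  ×-cancelˡ n {a} {b} eq = *-cancelˡ-#0 (<⇒# (0<1+n n)) (trans (as-multiple a) (trans eq (sym (as-multiple b))))
    where
    as-multiple : ∀ a → (suc n ×′ 1#) * a ≈ suc n ×′ a
    as-multiple a = trans (×′-assoc-* (suc n) 1# a) (×′-congʳ (suc n) (*-identityˡ a))

-- Polynomial functions: degrees and leading coefficients by finite differences.

module PolynomialFunctions {c ℓ₁ ℓ₂ ℓ₃} (K : OrderedField c ℓ₁ ℓ₂ ℓ₃) where
  open OrderedField K using (_<_; 0<1; commutativeRing; isStrictPartialOrder)
  open CommutativeRing commutativeRing hiding (zero)
  open IsStrictPartialOrder isStrictPartialOrder using () renaming (trans to <-trans; irrefl to <-irrefl)
  open GroupProperties +-group using () renaming (∙-cancelˡ to +-cancelˡ)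
  open SemiringMult semiring using (×-congʳ; ×-comm-*) renaming (_×_ to _×′_)
  open CommutativeMonoidMult +-commutativeMonoid using (×-distrib-+)
  open SemiringSum semiring using (sum; sum-replicate-zero; sum-replicate)
  open SemiringSolver commutativeSemiring using (solve; _:=_; _:+_; _:*_)
  open OrderedFieldProperties K
  open SetoidReasoning setoid

  -- Lead n a F: F is a polynomial function with leading term a·tⁿ (a may be zero).
  -- Differencing turns a·tⁿ into (n a)·tⁿ⁻¹ plus lower terms.
  Lead : ℕ → Carrier → (Carrier → Carrier) → Set (c ⊔ ℓ₁)
  Lead zero    a F = ∀ t → F t ≈ a
  Lead (suc n) a F = Σ (Carrier → Carrier) λ G →
    (∀ t → F (t + 1#) ≈ F t + G t) × Lead n (suc n ×′ a) G

  lead-cong : ∀ n {a b F G} → a ≈ b → (∀ t → F t ≈ G t) → Lead n a F → Lead n b G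
  lead-cong zero    a≈b F≈G lead = λ t → trans (sym (F≈G t)) (trans (lead t) a≈b)
  lead-cong (suc n) a≈b F≈G (D , diff , lead) =
    D , (λ t → trans (sym (F≈G (t + 1#))) (trans (diff t) (+-congʳ (F≈G t)))) ,
    lead-cong n (×-congʳ (suc n) a≈b) (λ _ → refl) lead

  lead-shift : ∀ n {a F} → Lead n a F → Lead n a (λ t → F (t + 1#))
  lead-shift zero    lead              = λ t → lead (t + 1#)
  lead-shift (suc n) (D , diff , lead) = (λ t → D (t + 1#)) , (λ t → diff (t + 1#)) , lead-shift n lead

  lead-scale : ∀ n x {a F} → Lead n a F → Lead n (x * a) (λ t → x * F t)
  lead-scale zero    x lead = λ t → *-congˡ (lead t)
  lead-scale (suc n) x (D , diff , lead) =
    (λ t → x * D t) , (λ t → trans (*-congˡ (diff t)) (distribˡ x _ _)) ,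
    lead-cong n (×-comm-* (suc n) x _) (λ _ → refl) (lead-scale n x lead)

  lead-+ : ∀ n {a b F G} → Lead n a F → Lead n b G → Lead n (a + b) (λ t → F t + G t)
  lead-+ zero    leadF leadG = λ t → +-cong (leadF t) (leadG t)
  lead-+ (suc n) (D , diffF , leadF) (E , diffG , leadG) =
    (λ t → D t + E t) ,
    (λ t → trans (+-cong (diffF t) (diffG t))
      (solve 4 (λ f d g e → (f :+ d) :+ (g :+ e) := (f :+ g) :+ (d :+ e)) refl _ _ _ _)) ,
    lead-cong n (sym (×-distrib-+ _ _ (suc n))) (λ _ → refl) (lead-+ n leadF leadG)

  ×-zeroʳ : ∀ n → n ×′ 0# ≈ 0#
  ×-zeroʳ n = trans (sym (sum-replicate n)) (sum-replicate-zero n)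

  -- The degree index is only an upper bound, so terms of lower degree can join a sum with
  -- coefficient 0.
  lead-raise : ∀ n {a F} → Lead n a F → Lead (suc n) 0# F
  lead-raise zero    lead = (λ _ → 0#) ,
    (λ t → trans (lead (t + 1#)) (trans (sym (lead t)) (sym (+-identityʳ _)))) , λ t → sym (×-zeroʳ 1)
  lead-raise (suc n) (D , diff , lead) =
    D , diff , lead-cong (suc n) (sym (×-zeroʳ (2 ℕ.+ n))) (λ _ → refl) (lead-raise n lead)

  lead-zero : ∀ n → Lead n 0# (λ _ → 0#)
  lead-zero zero    = λ _ → refl
  lead-zero (suc n) = lead-raise n (lead-zero n)

  lead-sum : ∀ n {m} (a : Vector Carrier m) (F : Fin m → Carrier → Carrier) →
    (∀ j → Lead n (a j) (F j)) → Lead n (sum a) (λ t → sum (λ j → F j t))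
  lead-sum n {zero}  a F leads = lead-zero n
  lead-sum n {suc m} a F leads = lead-+ n (leads zero) (lead-sum n (tail a) (F ∘ suc) (leads ∘ suc))

  lead-sum-0 : ∀ n {m} (F : Fin m → Carrier → Carrier) →
    (∀ j → Lead n 0# (F j)) → Lead n 0# (λ t → sum (λ j → F j t))
  lead-sum-0 n {m} F leads = lead-cong n (sum-replicate-zero m) (λ _ → refl) (lead-sum n (λ _ → 0#) F leads)

  -- Discrete product rule: the difference of `t * F t` is `t * D t + F (t + 1#)`. For `F` of degree
  -- `n + 1` the leading coefficients `(n + 1) a` and `a` add up to `(n + 2) a`.
  lead-t* : ∀ n {a F} → Lead n a F → Lead (suc n) a (λ t → t * F t)
  lead-t* zero {a} {F} lead = (λ _ → a) , (λ t → begin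
    (t + 1#) * F (t + 1#) ≈⟨ distribʳ _ t 1# ⟩
    t * F (t + 1#) + 1# * F (t + 1#) ≈⟨ +-cong (*-congˡ (trans (lead _) (sym (lead t)))) (trans (*-identityˡ _) (lead _)) ⟩
    t * F t + a ∎) , λ t → sym (+-identityʳ a)
  lead-t* (suc n) {a} {F} lead@(D , diff , leadD) =
    (λ t → t * D t + F (t + 1#)) ,
    (λ t → begin
      (t + 1#) * F (t + 1#)             ≈⟨ distribʳ _ t 1# ⟩
      t * F (t + 1#) + 1# * F (t + 1#)  ≈⟨ +-cong (trans (*-congˡ (diff t)) (distribˡ t _ _)) (*-identityˡ _) ⟩
      (t * F t + t * D t) + F (t + 1#)  ≈⟨ +-assoc _ _ _ ⟩
      t * F t + (t * D t + F (t + 1#))  ∎) ,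
    lead-cong (suc n) (+-comm _ a) (λ _ → refl)
      (lead-+ (suc n) (lead-t* n leadD) (lead-shift (suc n) lead))

  lead-linear* : ∀ n a b {x F} → Lead n x F → Lead (suc n) (b * x) (λ t → (t * b - a) * F t)
  lead-linear* n a b {x} {F} lead = lead-cong (suc n) lead≈ (λ t → begin
    b * (t * F t) + (- a) * F t ≈⟨ solve 4 (λ b t f a → b :* (t :* f) :+ a :* f := (t :* b :+ a) :* f) refl b t (F t) (- a) ⟩
    (t * b - a) * F t           ∎)
    (lead-+ (suc n) (lead-scale (suc n) b (lead-t* n lead)) (lead-scale (suc n) (- a) (lead-raise n lead)))
    where
    lead≈ : b * x + (- a) * 0# ≈ b * x
    lead≈ = trans (+-congˡ (zeroʳ _)) (+-identityʳ _)

  -- Differencing `n` times leaves the constant `n! a`, and positive integers cancel. The difference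
  -- functions of the two witnesses agree pointwise.
  lead-unique : ∀ n {a b F} → Lead n a F → Lead n b F → a ≈ b
  lead-unique zero    leadA leadB = trans (sym (leadA 0#)) (leadB 0#)
  lead-unique (suc n) (D , diffA , leadA) (E , diffB , leadB) = ×-cancelˡ n
    (lead-unique n leadA (lead-cong n refl (λ t → +-cancelˡ _ _ _ (trans (sym (diffB t)) (diffA t))) leadB))

  lead-raise-<′ : ∀ {n m a F} → n ℕ.<′ m → Lead n a F → Lead m 0# F
  lead-raise-<′ ℕ.≤′-refl       lead = lead-raise _ lead
  lead-raise-<′ (ℕ.≤′-step n<m) lead = lead-raise _ (lead-raise-<′ n<m lead)

  1≉0 : ¬ 1# ≈ 0#
  1≉0 1≈0 = <-irrefl (sym 1≈0) 0<1

  -- Otherwise the coefficient at the larger degree would be both 1 and 0.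
  monic-degree-unique : ∀ n m {F} → Lead n 1# F → Lead m 1# F → n ≡ m
  monic-degree-unique n m leadN leadM with ℕₚ.<-cmp n m
  ... | tri< n<m _ _ = ⊥-elim (1≉0 (lead-unique m leadM (lead-raise-<′ (ℕₚ.<⇒<′ n<m) leadN)))
  ... | tri≈ _ n≡m _ = n≡m
  ... | tri> _ _ m<n = ⊥-elim (1≉0 (lead-unique n leadN (lead-raise-<′ (ℕₚ.<⇒<′ m<n) leadM)))

  -- An algebraic substitute for continuity: the difference `D` also vanishes beyond `s`, hence at
  -- `s` by induction, so that `F s` equals `F (s + 1#)`, which is 0.
  vanishes-at-endpoint : ∀ n {a F} s → Lead n a F → (∀ t → s < t → F t ≈ 0#) → F s ≈ 0#
  vanishes-at-endpoint zero s lead F≈0 =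
    trans (lead s) (trans (sym (lead (s + 1#))) (F≈0 _ (x<x+1 s)))
  vanishes-at-endpoint (suc n) {F = F} s (D , diff , lead) F≈0 = begin
    F s            ≈⟨ +-identityʳ _ ⟨
    F s + 0#       ≈⟨ +-congˡ D-vanishes ⟨
    F s + D s      ≈⟨ diff s ⟨
    F (s + 1#)     ≈⟨ F≈0 _ (x<x+1 s) ⟩
    0#             ∎
    where
    D-vanishes : D s ≈ 0#
    D-vanishes = vanishes-at-endpoint n s lead λ t s<t → begin
      D t        ≈⟨ +-identityˡ _ ⟨
      0# + D t   ≈⟨ +-congʳ (F≈0 t s<t) ⟨
      F t + D t  ≈⟨ diff t ⟨
      F (t + 1#) ≈⟨ F≈0 _ (<-trans s<t (x<x+1 t)) ⟩
      0#         ∎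

-- Matrix products, powers and traces.

module MatrixProperties {c ℓ} (R : CommutativeRing c ℓ) where
  open CommutativeRing R hiding (zero)
  open SemiringSum semiring using (sum; sum-cong-≋; ∑-comm; *-distribˡ-sum; *-distribʳ-sum)
  open Matrices R
  open Determinants R using (sum-I; I-sym)
  open SetoidReasoning setoid

  trace : ∀ {n} → Matrix n → Carrier
  trace A = sum (λ i → A i i)

  sum-Iˡ : ∀ {n} (f : Vector Carrier n) k → sum (λ i → I k i * f i) ≈ f k
  sum-Iˡ f k = trans (sum-cong-≋ {x = λ i → I k i * f i} {λ i → f i * I i k}
    (λ i → trans (*-comm _ _) (*-congˡ (reflexive (I-sym k i))))) (sum-I f k)

  ·-cong : ∀ {n} {A A′ B B′ : Matrix n} → (∀ i j → A i j ≈ A′ i j) → (∀ i j → B i j ≈ B′ i j) →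
    ∀ i j → (A · B) i j ≈ (A′ · B′) i j
  ·-cong A≈ B≈ i j = sum-cong-≋ λ k → *-cong (A≈ i k) (B≈ k j)

  ·-assoc : ∀ {n} (A B C : Matrix n) i j → ((A · B) · C) i j ≈ (A · (B · C)) i j
  ·-assoc A B C i j = begin
    sum (λ k → sum (λ l → A i l * B l k) * C k j)
      ≈⟨ sum-cong-≋ (λ k → *-distribʳ-sum (C k j) (λ l → A i l * B l k)) ⟩
    sum (λ k → sum (λ l → A i l * B l k * C k j))
      ≈⟨ ∑-comm (λ k l → A i l * B l k * C k j) ⟩
    sum (λ l → sum (λ k → A i l * B l k * C k j))
      ≈⟨ sum-cong-≋ (λ l → trans
           (sum-cong-≋ {x = λ k → A i l * B l k * C k j} {λ k → A i l * (B l k * C k j)} (λ k → *-assoc _ _ _))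
           (sym (*-distribˡ-sum (A i l) (λ k → B l k * C k j)))) ⟩
    sum (λ l → A i l * sum (λ k → B l k * C k j)) ∎

  power-+ : ∀ {n} (A : Matrix n) k l i j → power A (k ℕ.+ l) i j ≈ (power A k · power A l) i j
  power-+ A zero    l i j = sym (sum-Iˡ (λ m → power A l m j) i)
  power-+ A (suc k) l i j = begin
    (A · power A (k ℕ.+ l)) i j         ≈⟨ ·-cong {A = A} (λ _ _ → refl) (power-+ A k l) i j ⟩
    (A · (power A k · power A l)) i j   ≈⟨ ·-assoc A (power A k) (power A l) i j ⟨
    ((A · power A k) · power A l) i j   ∎

  power-1 : ∀ {n} (A : Matrix n) i j → power A 1 i j ≈ A i j
  power-1 A i j = sum-I (A i) j

  power-sucʳ : ∀ {n} (A : Matrix n) k i j → power A (suc k) i j ≈ (power A k · A) i j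
  power-sucʳ A k i j = begin
    power A (suc k) i j              ≈⟨ reflexive (≡.cong (λ m → power A m i j) (ℕₚ.+-comm 1 k)) ⟩
    power A (k ℕ.+ 1) i j            ≈⟨ power-+ A k 1 i j ⟩
    (power A k · power A 1) i j      ≈⟨ ·-cong {A = power A k} (λ _ _ → refl) (power-1 A) i j ⟩
    (power A k · A) i j              ∎

  power-sym : ∀ {n} (A : Matrix n) → (∀ i j → A i j ≈ A j i) → ∀ k i j → power A k i j ≈ power A k j i
  power-sym A A-sym zero    i j = reflexive (I-sym i j)
  power-sym A A-sym (suc k) i j = begin
    power A (suc k) i j   ≈⟨ sum-cong-≋ (λ l → trans (*-cong (A-sym i l) (power-sym A A-sym k l j)) (*-comm _ _)) ⟩
    (power A k · A) j i   ≈⟨ power-sucʳ A k j i ⟨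
    power A (suc k) j i   ∎

-- Characteristic polynomials and adjugate traces.

module CharacteristicPolynomials {c ℓ₁ ℓ₂ ℓ₃} (K : OrderedField c ℓ₁ ℓ₂ ℓ₃) where
  open OrderedField K using (_<_; commutativeRing)
  open CommutativeRing commutativeRing hiding (zero)
  open GroupProperties +-group using (x∙y⁻¹≈ε⇒x≈y; ⁻¹-involutive) renaming (∙-cancelˡ to +-cancelˡ; ∙-cancelʳ to +-cancelʳ)
  open RingProperties ring using (-1*x≈-x)
  open RawSemiringDefinitions (Semiring.rawSemiring semiring) using (_^_)
  open SemiringSum semiring using (sum; sum-cong-≋; ∑-distrib-+; ∑-comm; *-distribˡ-sum)
  open SemiringSolver commutativeSemiring using (solve; _:=_; _:+_; _:*_)
  open Matrices commutativeRing
  open Determinants commutativeRing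
  open MatrixProperties commutativeRing
  open OrderedFieldProperties K
  open PolynomialFunctions K
  open SetoidReasoning setoid

  -- A general `E` instead of `I` makes minors, and matrices with some rows free of `t`, pencils
  -- again.
  pencil : ∀ {n} → Matrix n → Matrix n → Carrier → Matrix n
  pencil A E t i j = t * E i j - A i j

  lead-det : ∀ {n} (A E : Matrix n) → ∃ λ a → Lead n a (λ t → det (pencil A E t))
  lead-det {zero}  A E = 1# , λ t → refl
  lead-det {suc n} A E = _ , lead-sum (suc n) _ (λ j t → laplaceTerm (pencil A E t) j)
    (λ j → lead-scale (suc n) (sign j) (lead-linear* n (A zero j) (E zero j) (proj₂ (lead-det (minor A j) (minor E j)))))

  -- A row free of `t` contributes no factor `t`, so the degree stays below `n`.
  lead-det-constant-row : ∀ {n} (A E : Matrix n) i → (∀ j → E i j ≈ 0#) →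
    Lead n 0# (λ t → det (pencil A E t))
  lead-det-constant-row {suc n} A E i E≈0 =
    lead-sum-0 (suc n) (λ j t → laplaceTerm (pencil A E t) j) (term i E≈0)
    where
    term : ∀ i → (∀ j → E i j ≈ 0#) → ∀ j → Lead (suc n) 0# (λ t → laplaceTerm (pencil A E t) j)
    term zero E≈0 j = lead-cong (suc n) (trans (*-congˡ (trans (*-congʳ (E≈0 j)) (zeroˡ _))) (zeroʳ _)) (λ _ → refl)
      (lead-scale (suc n) (sign j) (lead-linear* n (A zero j) (E zero j) (proj₂ (lead-det (minor A j) (minor E j)))))
    term (suc i) E≈0 j = lead-cong (suc n) (trans (*-congˡ (zeroʳ _)) (zeroʳ _)) (λ _ → refl)
      (lead-scale (suc n) (sign j) (lead-linear* n (A zero j) (E zero j)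
        (lead-det-constant-row (minor A j) (minor E j) i (λ k → E≈0 (punchIn j k)))))

  -- Only the first Laplace term reaches full degree, and its minor is the pencil of a smaller
  -- characteristic polynomial.
  charPoly-monic : ∀ {n} (A : Matrix n) → Lead n 1# (charPoly A)
  charPoly-monic {zero}  A = λ t → refl
  charPoly-monic {suc n} A = lead-cong (suc n) leading (λ _ → refl)
    (lead-sum (suc n) a (λ j t → laplaceTerm (pencil A I t) j)
      (λ j → lead-scale (suc n) (sign j) (lead-linear* n (A zero j) (I zero j) (proj₂ (minor-lead j)))))
    where
    minor-lead : ∀ j → ∃ λ a → Lead n a (λ t → det (minor (pencil A I t) j))
    minor-lead zero    = 1# , charPoly-monic (minor A zero)
    -- This coefficient gets multiplied by `I zero (suc j)`, which is 0, so any value serves.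
    minor-lead (suc j) = lead-det (minor A (suc j)) (minor I (suc j))
    a : Vector Carrier (suc n)
    a j = sign j * (I zero j * proj₁ (minor-lead j))
    leading : sum a ≈ 1#
    leading = begin
      1# * (1# * 1#) + sum (tail a)
        ≈⟨ +-cong (trans (*-identityˡ _) (*-identityˡ _)) (sum-zero {f = tail a} (λ j → trans (*-congˡ {sign (suc j)} (zeroˡ _)) (zeroʳ _))) ⟩
      1# + 0# ≈⟨ +-identityʳ 1# ⟩
      1# ∎

  -- A row `w` free of `t` is written as `t * 0# - - w`, which turns a splice of pencils into a
  -- pencil.
  splice-pencil : ∀ {n} i (w : Vector Carrier n) (A B E F : Matrix n) t k l →
    splice i (λ j → t * 0# - - w j) (pencil A E t) (pencil B F t) k l ≈
    pencil (splice i (λ j → - w j) A B) (splice i (λ _ → 0#) E F) t k l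
  splice-pencil i w A B E F t k l = reflexive (≡.cong (λ v → v l) (unfold i {w} A B E F k))
    where
    unfold : ∀ {n m} i {w : Vector Carrier m} (A B E F : Vector (Vector Carrier m) n) k →
      splice i (λ j → t * 0# - - w j) (λ i j → t * E i j - A i j) (λ i j → t * F i j - B i j) k ≡
      (λ l → t * splice i (λ _ → 0#) E F k l - splice i (λ j → - w j) A B k l)
    unfold zero    A B E F zero    = ≡.refl
    unfold zero    A B E F (suc k) = ≡.refl
    unfold (suc i) A B E F zero    = ≡.refl
    unfold (suc i) {w} A B E F (suc k) = unfold i {w} (tail A) (tail B) (tail E) (tail F) k

  constant-pencil : ∀ t x → t * 0# - - x ≈ x
  constant-pencil t x = trans (+-cong (zeroʳ t) (⁻¹-involutive x)) (+-identityˡ x)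

  det-splice-pencil : ∀ {n} i (w : Vector Carrier n) (A B E F : Matrix n) t →
    det (pencil (splice i (λ j → - w j) A B) (splice i (λ _ → 0#) E F) t) ≈
    det (splice i w (pencil A E t) (pencil B F t))
  det-splice-pencil i w A B E F t = trans
    (det-cong _ _ (λ k l → sym (splice-pencil i w A B E F t k l)))
    (det-row-cong i _ _ (λ j → constant-pencil t (w j)))

  -- This is `u_k`: the adjugate is the transposed cofactor matrix, so the trace of the product
  -- pairs equal indices.
  adjugateTrace : ∀ {n} → Matrix n → ℕ → Carrier → Carrier
  adjugateTrace A k t = sum λ i → sum λ j → power A k i j * cofactor (pencil A I t) i j

  -- Row `i` of the matrix behind each cofactor is a unit row, free of `t`.
  lead-adjugateTrace : ∀ {n} (A : Matrix n) k → Lead n 0# (adjugateTrace A k)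
  lead-adjugateTrace {n} A k =
    lead-sum-0 n (λ i t → sum λ j → power A k i j * cofactor (pencil A I t) i j) λ i →
      lead-sum-0 n (λ j t → power A k i j * cofactor (pencil A I t) i j) λ j →
        lead-cong n (zeroʳ _) (λ t → *-congˡ (det-splice-pencil i (I j) A A I I t))
          (lead-scale n (power A k i j)
            (lead-det-constant-row _ _ i (λ l → reflexive (≡.cong (λ v → v l) (splice-self i (λ _ → 0#) I I)))))

  -- The identity `(t - A) adj (t - A) = p`, given entrywise by `entry`, is multiplied by the `k`-th
  -- power of `A` and traced.
  adjugateTrace-suc : ∀ {n} (A : Matrix n) k t →
    adjugateTrace A (suc k) t + charPoly A t * trace (power A k) ≈ t * adjugateTrace A k t
  adjugateTrace-suc {n} A k t = begin
    adjugateTrace A (suc k) t + p * trace P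
      ≈⟨ +-cong (sum-cong-≋ suc-row) (trans (*-distribˡ-sum p (λ i → P i i)) (sum-cong-≋ trace-row)) ⟩
    sum (λ i → sum (λ l → P i l * sum (λ j → A l j * C i j))) + sum (λ i → sum (λ l → P i l * (p * I i l)))
      ≈⟨ ∑-distrib-+ (λ i → sum (λ l → P i l * sum (λ j → A l j * C i j))) (λ i → sum (λ l → P i l * (p * I i l))) ⟨
    sum (λ i → sum (λ l → P i l * sum (λ j → A l j * C i j)) + sum (λ l → P i l * (p * I i l)))
      ≈⟨ sum-cong-≋ row ⟩
    sum (λ i → t * sum (λ l → P i l * C i l))
      ≈⟨ *-distribˡ-sum t (λ i → sum (λ l → P i l * C i l)) ⟨
    t * adjugateTrace A k t ∎
    where
    p : Carrier
    p = charPoly A t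
    P C : Matrix n
    P = power A k
    C = cofactor (pencil A I t)
    suc-row : ∀ i → sum (λ j → power A (suc k) i j * C i j) ≈ sum (λ l → P i l * sum (λ j → A l j * C i j))
    suc-row i = begin
      sum (λ j → power A (suc k) i j * C i j)
        ≈⟨ sum-cong-≋ (λ j → trans (*-congʳ (power-sucʳ A k i j)) (*-comm _ _)) ⟩
      sum (λ j → C i j * sum (λ l → P i l * A l j))
        ≈⟨ sum-cong-≋ (λ j → *-distribˡ-sum (C i j) (λ l → P i l * A l j)) ⟩
      sum (λ j → sum (λ l → C i j * (P i l * A l j)))
        ≈⟨ ∑-comm (λ j l → C i j * (P i l * A l j)) ⟩
      sum (λ l → sum (λ j → C i j * (P i l * A l j)))
        ≈⟨ sum-cong-≋ (λ l → trans
             (sum-cong-≋ (λ j → solve 3 (λ c p a → c :* (p :* a) := p :* (a :* c)) refl (C i j) (P i l) (A l j)))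
             (sym (*-distribˡ-sum (P i l) (λ j → A l j * C i j)))) ⟩
      sum (λ l → P i l * sum (λ j → A l j * C i j)) ∎
    trace-row : ∀ i → p * P i i ≈ sum (λ l → P i l * (p * I i l))
    trace-row i = begin
      p * P i i                      ≈⟨ sum-Iˡ (λ l → p * P i l) i ⟨
      sum (λ l → I i l * (p * P i l)) ≈⟨ sum-cong-≋ (λ l → solve 3 (λ e p x → e :* (p :* x) := x :* (p :* e)) refl (I i l) p (P i l)) ⟩
      sum (λ l → P i l * (p * I i l)) ∎
    entry : ∀ i l → sum (λ j → A l j * C i j) + p * I i l ≈ t * C i l
    entry i l = begin
      sum (λ j → A l j * C i j) + p * I i l
        ≈⟨ +-congˡ (cofactor-expansion (pencil A I t) i l) ⟨
      sum (λ j → A l j * C i j) + sum (λ j → (t * I l j - A l j) * C i j)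
        ≈⟨ ∑-distrib-+ (λ j → A l j * C i j) (λ j → (t * I l j - A l j) * C i j) ⟨
      sum (λ j → A l j * C i j + (t * I l j - A l j) * C i j)
        ≈⟨ sum-cong-≋ (λ j → cancel (A l j) (I l j) (C i j)) ⟩
      sum (λ j → I l j * (t * C i j))
        ≈⟨ sum-Iˡ (λ j → t * C i j) l ⟩
      t * C i l ∎
      where
      cancel : ∀ a e c → a * c + (t * e - a) * c ≈ e * (t * c)
      cancel a e c = begin
        a * c + (t * e - a) * c
          ≈⟨ solve 5 (λ t e a b c → a :* c :+ (t :* e :+ b) :* c := (a :+ b) :* c :+ e :* (t :* c)) refl t e a (- a) c ⟩
        (a - a) * c + e * (t * c) ≈⟨ +-congʳ (trans (*-congʳ (-‿inverseʳ a)) (zeroˡ c)) ⟩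
        0# + e * (t * c)          ≈⟨ +-identityˡ _ ⟩
        e * (t * c)               ∎
    row : ∀ i → sum (λ l → P i l * sum (λ j → A l j * C i j)) + sum (λ l → P i l * (p * I i l)) ≈
      t * sum (λ l → P i l * C i l)
    row i = begin
      sum (λ l → P i l * sum (λ j → A l j * C i j)) + sum (λ l → P i l * (p * I i l))
        ≈⟨ ∑-distrib-+ (λ l → P i l * sum (λ j → A l j * C i j)) (λ l → P i l * (p * I i l)) ⟨
      sum (λ l → P i l * sum (λ j → A l j * C i j) + P i l * (p * I i l))
        ≈⟨ sum-cong-≋ (λ l → begin
             P i l * sum (λ j → A l j * C i j) + P i l * (p * I i l) ≈⟨ distribˡ (P i l) _ _ ⟨
             P i l * (sum (λ j → A l j * C i j) + p * I i l)         ≈⟨ *-congˡ (entry i l) ⟩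
             P i l * (t * C i l) ≈⟨ solve 3 (λ p t c → p :* (t :* c) := t :* (p :* c)) refl (P i l) t (C i l) ⟩
             t * (P i l * C i l) ∎) ⟩
      sum (λ l → t * (P i l * C i l)) ≈⟨ *-distribˡ-sum t (λ l → P i l * C i l) ⟨
      t * sum (λ l → P i l * C i l)   ∎

  -- The derivative of the characteristic polynomial through divided differences.

  -- The quotient of `p t - p s` by `t - s` for `p = charPoly A`, written without division so that
  -- it makes sense at `s = t`, where it is the derivative.
  dividedDifference : ∀ {n} → Matrix n → Carrier → Carrier → Carrier
  dividedDifference A s t = sum λ i → det (splice i (I i) (pencil A I t) (pencil A I s))

  -- Rows are moved from `t` to `s` one at a time. Row `i` changes by `(t - s)` times the unit row
  -- `I i`, and multilinearity isolates that change.
  dividedDifference-correct : ∀ {n} (A : Matrix n) s t →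
    charPoly A t ≈ charPoly A s + (t - s) * dividedDifference A s t
  dividedDifference-correct {n} A s t = begin
    charPoly A t
      ≈⟨ telescope det (λ x≡y → det-cong _ _ (λ k l → reflexive (≡.cong (λ v → v l) (x≡y k)))) X Y
           (λ i → (t - s) * det (splice i (I i) X Y)) step ⟩
    charPoly A s + sum (λ i → (t - s) * det (splice i (I i) X Y))
      ≈⟨ +-congˡ (*-distribˡ-sum (t - s) (λ i → det (splice i (I i) X Y))) ⟨
    charPoly A s + (t - s) * dividedDifference A s t ∎
    where
    X Y : Matrix n
    X = pencil A I t
    Y = pencil A I s
    split : ∀ e a → t * e - a ≈ (s * e - a) + (t - s) * e
    split e a = begin
      t * e - a                     ≈⟨ +-identityˡ _ ⟨
      0# + (t * e - a)              ≈⟨ +-congʳ (trans (*-congʳ (-‿inverseʳ s)) (zeroˡ e)) ⟨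
      (s - s) * e + (t * e - a)     ≈⟨ solve 5 (λ s r e t a → (s :+ r) :* e :+ (t :* e :+ a) := (s :* e :+ a) :+ (t :+ r) :* e)
                                         refl s (- s) e t (- a) ⟩
      (s * e - a) + (t - s) * e     ∎
    step : ∀ i → det (splice i (X i) X Y) ≈ det (splice i (Y i) X Y) + (t - s) * det (splice i (I i) X Y)
    step i = begin
      det (splice i (X i) X Y)
        ≈⟨ det-row-cong i X Y (λ j → split (I i j) (A i j)) ⟩
      det (splice i (λ j → Y i j + (t - s) * I i j) X Y)
        ≈⟨ det-row-+ i (Y i) (λ j → (t - s) * I i j) X Y ⟩
      det (splice i (Y i) X Y) + det (splice i (λ j → (t - s) * I i j) X Y)
        ≈⟨ +-congˡ (det-row-* i (t - s) (I i) X Y) ⟩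
      det (splice i (Y i) X Y) + (t - s) * det (splice i (I i) X Y) ∎

  lead-dividedDifference : ∀ {n} (A : Matrix n) s → ∃ λ a → Lead n a (dividedDifference A s)
  lead-dividedDifference {n} A s = _ ,
    lead-sum n _ (λ i t → det (splice i (I i) (pencil A I t) (pencil A I s))) (λ i → proj₂ (term i))
    where
    -- Rows taken at the fixed `s` are free of `t`: as pencil rows they have coefficient part 0.
    zeroMatrix : Matrix n
    zeroMatrix _ _ = 0#
    constant : Matrix n
    constant i j = - pencil A I s i j
    term : ∀ i → ∃ λ a → Lead n a (λ t → det (splice i (I i) (pencil A I t) (pencil A I s)))
    term i = _ , lead-cong n refl
      (λ t → trans (det-splice-pencil i (I i) A constant I zeroMatrix t)
        (det-cong _ _ (splice-congʳ i (pencil A I t) (λ k l → constant-pencil t (pencil A I s k l)))))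
      (proj₂ (lead-det (splice i (λ j → - I i j) A constant) (splice i (λ _ → 0#) I zeroMatrix)))
      where
      splice-congʳ : ∀ {n m} i {w : Vector Carrier m} (x : Vector (Vector Carrier m) n) {y z : Vector (Vector Carrier m) n} →
        (∀ k l → y k l ≈ z k l) → ∀ k l → splice i w x y k l ≈ splice i w x z k l
      splice-congʳ zero    x y≈z zero    l = refl
      splice-congʳ zero    x y≈z (suc k) l = refl
      splice-congʳ (suc i) x y≈z zero    l = y≈z zero l
      splice-congʳ (suc i) x y≈z (suc k) l = splice-congʳ i (tail x) (y≈z ∘ suc) k l

  -- At `s = t` the splice is a `replace`, so both sides are the sum of the diagonal cofactors.
  adjugateTrace-0 : ∀ {n} (A : Matrix n) t → adjugateTrace A 0 t ≈ dividedDifference A t t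
  adjugateTrace-0 A t = sum-cong-≋ (λ i → sum-Iˡ (λ j → cofactor (pencil A I t) i j) i)

  module _ {n} (A B : Matrix n) (charPoly-≈ : ∀ t → charPoly A t ≈ charPoly B t) where

    -- For `t` beyond `s` the factor `t - s` cancels; `vanishes-at-endpoint` extends the equality to
    -- `t = s`.
    dividedDifference-≈ : ∀ t → dividedDifference A t t ≈ dividedDifference B t t
    dividedDifference-≈ s = x∙y⁻¹≈ε⇒x≈y _ _ (trans (+-congˡ (sym (-1*x≈-x _)))
      (vanishes-at-endpoint n s
        (lead-+ n (proj₂ (lead-dividedDifference A s)) (lead-scale n (- 1#) (proj₂ (lead-dividedDifference B s))))
        (λ t s<t → trans (+-cong (agree t s<t) (-1*x≈-x _)) (-‿inverseʳ _))))
      where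
      agree : ∀ t → s < t → dividedDifference A s t ≈ dividedDifference B s t
      agree t s<t = *-cancelˡ-# (<⇒# s<t) (+-cancelˡ (charPoly A s) _ _ (begin
        charPoly A s + (t - s) * dividedDifference A s t ≈⟨ dividedDifference-correct A s t ⟨
        charPoly A t                                     ≈⟨ charPoly-≈ t ⟩
        charPoly B t                                     ≈⟨ dividedDifference-correct B s t ⟩
        charPoly B s + (t - s) * dividedDifference B s t ≈⟨ +-congʳ (charPoly-≈ s) ⟨
        charPoly A s + (t - s) * dividedDifference B s t ∎))

    mutual
      -- Starting from the common derivative, equality of `u_k` gives equality of `t u_k`, then of
      -- the `k`-th traces, then of `u_{k+1}`.
      adjugateTrace-≈ : ∀ k t → adjugateTrace A k t ≈ adjugateTrace B k t
      adjugateTrace-≈ zero t = trans (adjugateTrace-0 A t) (trans (dividedDifference-≈ t) (sym (adjugateTrace-0 B t)))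
      adjugateTrace-≈ (suc k) t = +-cancelʳ _ _ _ (begin
        adjugateTrace A (suc k) t + charPoly A t * trace (power A k) ≈⟨ recurrence-≈ k t ⟩
        adjugateTrace B (suc k) t + charPoly B t * trace (power B k)
          ≈⟨ +-congˡ (*-cong (charPoly-≈ t) (trace-power-≈ k)) ⟨
        adjugateTrace B (suc k) t + charPoly A t * trace (power A k) ∎)

      -- adjugateTrace has degree below n and charPoly is monic of degree n,
      -- so the traces are the coefficients of tⁿ on the two sides of recurrence-≈.
      trace-power-≈ : ∀ k → trace (power A k) ≈ trace (power B k)
      trace-power-≈ k = lead-unique n (lead A) (lead-cong n refl (λ t → sym (recurrence-≈ k t)) (lead B))
        where
        lead : ∀ C → Lead n (trace (power C k)) (λ t → adjugateTrace C (suc k) t + charPoly C t * trace (power C k))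
        lead C = lead-cong n (trans (+-identityˡ _) (*-identityʳ _)) (λ t → +-congˡ (*-comm _ _))
          (lead-+ n (lead-adjugateTrace C (suc k)) (lead-scale n (trace (power C k)) (charPoly-monic C)))

      recurrence-≈ : ∀ k t →
        adjugateTrace A (suc k) t + charPoly A t * trace (power A k) ≈
        adjugateTrace B (suc k) t + charPoly B t * trace (power B k)
      recurrence-≈ k t = begin
        _                       ≈⟨ adjugateTrace-suc A k t ⟩
        t * adjugateTrace A k t ≈⟨ *-congˡ (adjugateTrace-≈ k t) ⟩
        t * adjugateTrace B k t ≈⟨ adjugateTrace-suc B k t ⟨
        _                       ∎

  -- Power sums of the spectrum.

  diagonal : (s : List Carrier) → Matrix (length s)
  diagonal s i j = lookup s i * I i j

  charPoly-diagonal : ∀ s t → charPoly (diagonal s) t ≈ foldr _*_ 1# (map (λ θ → t - θ) s)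
  charPoly-diagonal []      t = refl
  charPoly-diagonal (x ∷ s) t = begin
    1# * ((t * 1# - x * 1#) * charPoly (diagonal s) t) + sum (tail (laplaceTerm (pencil (diagonal (x ∷ s)) I t)))
      ≈⟨ +-cong (trans (*-identityˡ _) (*-cong (+-cong (*-identityʳ t) (-‿cong (*-identityʳ x))) (charPoly-diagonal s t)))
           (sum-zero {f = tail (laplaceTerm (pencil (diagonal (x ∷ s)) I t))} off-diagonal) ⟩
    (t - x) * foldr _*_ 1# (map (λ θ → t - θ) s) + 0#
      ≈⟨ +-identityʳ _ ⟩
    (t - x) * foldr _*_ 1# (map (λ θ → t - θ) s) ∎
    where
    off-diagonal : ∀ j → laplaceTerm (pencil (diagonal (x ∷ s)) I t) (suc j) ≈ 0#
    off-diagonal j = trans (*-congˡ (trans (*-congʳ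
      (trans (+-cong (zeroʳ t) (-‿cong (zeroʳ x))) (-‿inverseʳ 0#))) (zeroˡ _))) (zeroʳ _)

  powerSum : ℕ → List Carrier → Carrier
  powerSum k s = foldr _+_ 0# (map (_^ k) s)

  power-diagonal : ∀ s k i j → power (diagonal s) k i j ≈ (lookup s i ^ k) * I i j
  power-diagonal s zero    i j = sym (*-identityˡ _)
  power-diagonal s (suc k) i j = begin
    sum (λ l → lookup s i * I i l * power (diagonal s) k l j)
      ≈⟨ sum-cong-≋ (λ l → solve 3 (λ x e p → x :* e :* p := e :* (x :* p)) refl (lookup s i) (I i l) (power (diagonal s) k l j)) ⟩
    sum (λ l → I i l * (lookup s i * power (diagonal s) k l j))
      ≈⟨ sum-Iˡ (λ l → lookup s i * power (diagonal s) k l j) i ⟩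
    lookup s i * power (diagonal s) k i j
      ≈⟨ *-congˡ (power-diagonal s k i j) ⟩
    lookup s i * ((lookup s i ^ k) * I i j)
      ≈⟨ *-assoc _ _ _ ⟨
    (lookup s i ^ suc k) * I i j ∎

  I-diagonal : ∀ {n} (i : Fin n) → I i i ≡ 1#
  I-diagonal zero    = ≡.refl
  I-diagonal (suc i) = I-diagonal i

  trace-power-diagonal : ∀ s k → trace (power (diagonal s) k) ≈ powerSum k s
  trace-power-diagonal s k = trans
    (sum-cong-≋ (λ i → trans (power-diagonal s k i i) (trans (*-congˡ (reflexive (I-diagonal i))) (*-identityʳ _))))
    (sum-lookup s)
    where
    sum-lookup : ∀ s → sum (λ i → lookup s i ^ k) ≈ powerSum k s
    sum-lookup []      = refl
    sum-lookup (x ∷ s) = +-congˡ (sum-lookup s)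

  -- The matrix is compared with the diagonal matrix of `s`. That `s` has length `n`, which makes
  -- the two matrices comparable, follows from both polynomials being monic.
  trace-power-spectrum : ∀ {n} (A : Matrix n) s → Spectra.IsSpectrum K A s →
    ∀ k → trace (power A k) ≈ powerSum k s
  trace-power-spectrum {n} A s spectrum k = by-size (monic-degree-unique n (length s) (charPoly-monic A)
      (lead-cong (length s) refl (λ t → sym (charPoly-≈ t)) (charPoly-monic (diagonal s)))) A charPoly-≈
    where
    charPoly-≈ : ∀ t → charPoly A t ≈ charPoly (diagonal s) t
    charPoly-≈ t = trans (spectrum t) (sym (charPoly-diagonal s t))
    by-size : ∀ {n} → n ≡ length s → (A : Matrix n) → (∀ t → charPoly A t ≈ charPoly (diagonal s) t) →
      trace (power A k) ≈ powerSum k s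
    by-size ≡.refl A A≈ = trans (trace-power-≈ A (diagonal s) A≈ k) (trace-power-diagonal s k)

-- Walk counts, linking integer matrices and matrices over a field.

module ℕSum = SemiringSum ℕₚ.+-*-semiring

indicator : ∀ {n} → Graph n → Fin n → Fin n → ℕ
indicator Y u v = if does (Graph.adj? Y u v) then 1 else 0

-- A common source for the integer matrices of `WalkRegular` and for the matrices over the ordered
-- field that carry the spectra.
walks : ∀ {n} → Graph n → ℕ → Fin n → Fin n → ℕ
walks Y zero    u v = if does (u ≟ v) then 1 else 0
walks Y (suc k) u v = ℕSum.sum λ w → indicator Y u w ℕ.* walks Y k w v

module Walks {c ℓ} (R : CommutativeRing c ℓ) where
  open CommutativeRing R hiding (zero)
  open SemiringMult semiring using (×-homo-+; ×1-homo-*) renaming (_×_ to _×′_)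
  open SemiringSum semiring using (sum; sum-cong-≋)
  open Matrices R

  if-×1 : ∀ b → (if b then 1# else 0#) ≈ (if b then 1 else 0) ×′ 1#
  if-×1 true  = sym (+-identityʳ 1#)
  if-×1 false = refl

  sum-×1 : ∀ {n} (f : Vector ℕ n) → ℕSum.sum f ×′ 1# ≈ sum (λ i → f i ×′ 1#)
  sum-×1 {zero}  f = refl
  sum-×1 {suc n} f = trans (×-homo-+ 1# (f zero) (ℕSum.sum (tail f))) (+-congˡ (sum-×1 (tail f)))

  power-adjacency : ∀ {n} (Y : Graph n) k u v → power (adjacency Y) k u v ≈ walks Y k u v ×′ 1#
  power-adjacency Y zero    u v = if-×1 (does (u ≟ v))
  power-adjacency Y (suc k) u v = trans
    (sum-cong-≋ (λ w → trans (*-cong (if-×1 (does (Graph.adj? Y u w))) (power-adjacency Y k w v))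
      (sym (×1-homo-* (indicator Y u w) (walks Y k w v)))))
    (sym (sum-×1 (λ w → indicator Y u w ℕ.* walks Y k w v)))

  adjacency-sym : ∀ {n} (Y : Graph n) u v → adjacency Y u v ≈ adjacency Y v u
  adjacency-sym Y u v with Graph.adj? Y u v
  ... | yes a = reflexive (≡.cong (if_then 1# else 0#) (≡.sym (dec-true (Graph.adj? Y v u) (Graph.adj-sym Y a))))
  ... | no ¬a = reflexive (≡.cong (if_then 1# else 0#) (≡.sym (dec-false (Graph.adj? Y v u) (¬a ∘ Graph.adj-sym Y))))

  adjacency-diagonal : ∀ {n} (Y : Graph n) u → adjacency Y u u ≈ 0#
  adjacency-diagonal Y u = reflexive (≡.cong (if_then 1# else 0#) (dec-false (Graph.adj? Y u u) (Graph.adj-irrefl Y u)))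

walkRegular-walks : ∀ {n} (Y : Graph n) → WalkRegular Y →
  ∀ k → 1 ℕ.≤ k → ∀ u v → walks Y k u u ≡ walks Y k v v
walkRegular-walks Y regular k 1≤k u v = ℤₚ.+-injective (≡.trans (≡.sym (power-ℤ u)) (≡.trans (regular k 1≤k u v) (power-ℤ v)))
  where
  open Matrices ℤₚ.+-*-commutativeRing
  open SemiringMult (CommutativeRing.semiring ℤₚ.+-*-commutativeRing) using () renaming (_×_ to _×′_)
  ×1-ℤ : ∀ m → m ×′ ℤ.1ℤ ≡ ℤ.+ m
  ×1-ℤ zero    = ≡.refl
  ×1-ℤ (suc m) = ≡.cong ℤ.suc (×1-ℤ m)
  power-ℤ : ∀ w → power (adjacency Y) k w w ≡ ℤ.+ walks Y k w w
  power-ℤ w = ≡.trans (Walks.power-adjacency ℤₚ.+-*-commutativeRing Y k w w) (×1-ℤ (walks Y k w w))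

walks-walkRegular : ∀ {n} (Y : Graph n) →
  (∀ k → 1 ℕ.≤ k → ∀ u v → walks Y k u u ≡ walks Y k v v) → WalkRegular Y
walks-walkRegular Y equal k 1≤k u v = ≡.trans (power-adjacency Y k u u)
  (≡.trans (≡.cong (_×′ ℤ.1ℤ) (equal k 1≤k u v)) (≡.sym (power-adjacency Y k v v)))
  where
  open Walks ℤₚ.+-*-commutativeRing using (power-adjacency)
  open SemiringMult (CommutativeRing.semiring ℤₚ.+-*-commutativeRing) using () renaming (_×_ to _×′_)

-- Sums of squares without decidable equality.

module SumsOfSquares {c ℓ₁ ℓ₂ ℓ₃} (K : OrderedField c ℓ₁ ℓ₂ ℓ₃) where
  open OrderedField K using (_#_; _<_; #⇔<⊎>; +-monoˡ-<; *-pos; tight; commutativeRing; isStrictPartialOrder)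
  open CommutativeRing commutativeRing hiding (zero)
  open IsStrictPartialOrder isStrictPartialOrder using (<-respˡ-≈; <-respʳ-≈) renaming (trans to <-trans; irrefl to <-irrefl)
  open GroupProperties +-group using () renaming (∙-cancelˡ to +-cancelˡ)
  open RingProperties ring using (-‿distribˡ-*; -‿distribʳ-*; -‿involutive)
  open SemiringMult semiring using () renaming (_×_ to _×′_)
  open SemiringSum semiring using (sum)
  open OrderedFieldProperties K
  open SetoidReasoning setoid

  ×1-injective : ∀ m n → m ×′ 1# ≈ n ×′ 1# → m ≡ n
  ×1-injective zero    zero    eq = ≡.refl
  ×1-injective zero    (suc n) eq = ⊥-elim (<-irrefl eq (0<1+n n))
  ×1-injective (suc m) zero    eq = ⊥-elim (<-irrefl (sym eq) (0<1+n m))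
  ×1-injective (suc m) (suc n) eq = ≡.cong suc (×1-injective m n (+-cancelˡ 1# _ _ eq))

  square-pos : ∀ {x} → x # 0# → 0# < x * x
  square-pos {x} x#0 with Equivalence.to #⇔<⊎> x#0
  ... | inj₂ 0<x = *-pos 0<x 0<x
  ... | inj₁ x<0 = <-respʳ-≈ -x*-x≈x*x (*-pos 0<-x 0<-x)
    where
    0<-x : 0# < - x
    0<-x = <-respˡ-≈ (-‿inverseʳ x) (<-respʳ-≈ (+-identityˡ (- x)) (+-monoˡ-< (- x) x<0))
    -x*-x≈x*x : - x * - x ≈ x * x
    -x*-x≈x*x = trans (sym (-‿distribˡ-* x (- x))) (trans (-‿cong (sym (-‿distribʳ-* x x))) (-‿involutive _))

  -- If neither case holds, `x` is not apart from 0, and tightness makes it 0 after all.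
  zero-or-square-pos : ∀ x → ¬ ¬ (x ≈ 0# ⊎ 0# < x * x)
  zero-or-square-pos x neither = neither (inj₁ (proj₁ (tight x 0#) (λ x#0 → neither (inj₂ (square-pos x#0)))))

  -- `P i` abstracts the reason for `f i` to vanish, so that one induction serves both single
  -- entries of a row and whole rows.
  sum-zero-or-pos : ∀ {p n} {P : Fin n → Set p} (f : Vector Carrier n) →
    (∀ i → P i → f i ≈ 0#) → (∀ i → ¬ ¬ (P i ⊎ 0# < f i)) → ¬ ¬ ((∀ i → P i) ⊎ 0# < sum f)
  sum-zero-or-pos {n = zero}  f vanish cases neither = neither (inj₁ (λ ()))
  sum-zero-or-pos {n = suc n} f vanish cases neither = cases zero λ head →
    sum-zero-or-pos (tail f) (vanish ∘ suc) (cases ∘ suc) λ rest → neither (combine head rest)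
    where
    combine : _ → _ → _
    combine (inj₁ p)   (inj₁ ps)  = inj₁ λ { zero → p ; (suc i) → ps i }
    combine (inj₁ p)   (inj₂ pos) = inj₂ (<-respʳ-≈ (trans (sym (+-identityˡ _)) (+-congʳ (sym (vanish zero p)))) pos)
    combine (inj₂ pos) (inj₁ ps)  = inj₂ (<-respʳ-≈ (trans (sym (+-identityʳ _))
      (+-congˡ (sym (Determinants.sum-zero commutativeRing (λ i → vanish (suc i) (ps i)))))) pos)
    combine (inj₂ pos) (inj₂ pos′) = inj₂ (<-trans pos′ (<-respˡ-≈ (+-identityˡ _) (+-monoˡ-< _ pos)))

  -- By tightness it suffices to refute an apartness, so the doubly negated alternative may be used:
  -- either all entries vanish or the sum is positive.
  sum-squares-zero : ∀ {m n} (N : Fin m → Fin n → Carrier) →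
    sum (λ i → sum (λ j → N i j * N i j)) ≈ 0# → ∀ i j → N i j ≈ 0#
  sum-squares-zero {m} {n} N sum≈0 i j = proj₁ (tight (N i j) 0#) λ N#0 →
    sum-zero-or-pos rows vanish (λ i → sum-zero-or-pos (λ j → N i j * N i j)
        (λ j N≈0 → trans (*-congʳ N≈0) (zeroˡ _)) (λ j → zero-or-square-pos (N i j)))
      λ { (inj₁ N≈0) → proj₂ (tight (N i j) 0#) (N≈0 i j) N#0
        ; (inj₂ pos) → <-irrefl (sym sum≈0) pos }
    where
    rows : Vector Carrier m
    rows i = sum (λ j → N i j * N i j)
    vanish : ∀ i → (∀ j → N i j ≈ 0#) → rows i ≈ 0#
    vanish i N≈0 = Determinants.sum-zero commutativeRing (λ j → trans (*-congʳ (N≈0 j)) (zeroˡ _))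

-- Summation over the fibres of a cover.

module FibreSums {c ℓ} (R : CommutativeRing c ℓ) where
  open CommutativeRing R hiding (zero)
  open SemiringSum semiring using (sum; sum-cong-≋; *-distribʳ-sum)
  open Matrices R
  open Determinants R using (sum-zero)
  open MatrixProperties R using (sum-Iˡ)
  open SetoidReasoning setoid

  sum-++ : ∀ m {n} (f : Vector Carrier (m ℕ.+ n)) → sum f ≈ sum (λ i → f (i ↑ˡ n)) + sum (λ j → f (m ↑ʳ j))
  sum-++ zero    f = sym (+-identityˡ _)
  sum-++ (suc m) f = trans (+-congˡ (sum-++ m (tail f))) (sym (+-assoc _ _ _))

  remQuot-↑ʳ : ∀ {n} r (x : Fin (n ℕ.* r)) → remQuot {suc n} r (r ↑ʳ x) ≡ map₁ suc (remQuot {n} r x)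
  remQuot-↑ʳ {n} r x rewrite splitAt-↑ʳ r (n ℕ.* r) x = ≡.refl

  sum-remQuot : ∀ n r (F : Fin n × Fin r → Carrier) →
    sum (λ x → F (remQuot {n} r x)) ≈ sum (λ v → sum (λ j → F (v , j)))
  sum-remQuot zero    r F = refl
  sum-remQuot (suc n) r F = begin
    sum (λ x → F (remQuot {suc n} r x))
      ≈⟨ sum-++ r (λ x → F (remQuot {suc n} r x)) ⟩
    sum (λ j → F (remQuot {suc n} r (j ↑ˡ (n ℕ.* r)))) + sum (λ x → F (remQuot {suc n} r (r ↑ʳ x)))
      ≈⟨ +-cong (sum-cong-≋ (λ j → reflexive (≡.cong F (remQuot-combine {suc n} zero j))))
           (sum-cong-≋ (λ x → reflexive (≡.cong F (remQuot-↑ʳ r x)))) ⟩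
    sum (λ j → F (zero , j)) + sum (λ x → F (map₁ suc (remQuot {n} r x)))
      ≈⟨ +-congˡ (sum-remQuot n r (F ∘ map₁ suc)) ⟩
    sum (λ j → F (zero , j)) + sum (λ v → sum (λ j → F (suc v , j))) ∎

  module _ {n r} {Y : Graph n} {G : PermutationGroup r} (f : SymmetricArcFunction Y G) where
    open Graph Y using (adj?; adj-sym)
    open SymmetricArcFunction f

    fibre : Fin (n ℕ.* r) → Fin n
    fibre x = proj₁ (remQuot r x)

    -- Over an edge the arc value is a permutation `g`, and the only neighbour in the fibre of `u`
    -- has index `g ⟨$⟩ʳ j`.
    fibre-sum : ∀ v j u →
      sum (λ k → if does (adj? v u ×-dec dec (λ g → g ⟨$⟩ʳ j ≟ k) (value u v)) then 1# else 0#) ≈ adjacency Y v u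
    fibre-sum v j u with adj? v u
    ... | no ¬a = sum-zero {r} {λ _ → 0#} (λ _ → refl)
    ... | yes a with value u v in eq
    ...   | nothing = ⊥-elim (Equivalence.to (value-zero u v) eq (adj-sym a))
    ...   | just g  = trans (sum-cong-≋ (λ k → sym (*-identityʳ (I (g ⟨$⟩ʳ j) k)))) (sum-Iˡ (λ _ → 1#) (g ⟨$⟩ʳ j))

    -- On functions constant on fibres, the adjacency matrix of the cover acts as that of the base.
    cover-row : ∀ x (h : Fin n → Carrier) →
      sum (λ y → adjacency (cover f) x y * h (fibre y)) ≈ sum (λ u → adjacency Y (fibre x) u * h u)
    cover-row x h = trans
      (sum-remQuot n r (λ (u , k) → (if does (adj? v u ×-dec dec (λ g → g ⟨$⟩ʳ j ≟ k) (value u v)) then 1# else 0#) * h u))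
      (sum-cong-≋ (λ u → trans
        (sym (*-distribʳ-sum (h u) (λ k → if does (adj? v u ×-dec dec (λ g → g ⟨$⟩ʳ j ≟ k) (value u v)) then 1# else 0#)))
        (*-congʳ (fibre-sum v j u))))
      where
      v = fibre x
      j = proj₂ (remQuot {n} r x)

-- Products and traces of the matrices `V k`.

module TwoEigenvalueCovers {c ℓ₁ ℓ₂ ℓ₃} (K : OrderedField c ℓ₁ ℓ₂ ℓ₃)
  {n r : ℕ} {Y : Graph n} {G : PermutationGroup r} (f : SymmetricArcFunction Y G) where
  open OrderedField K using (_#_; commutativeRing)
  open CommutativeRing commutativeRing hiding (zero)
  open GroupProperties +-group using () renaming (∙-cancelʳ to +-cancelʳ)
  open RingProperties ring using (-1*x≈-x)
  open RawSemiringDefinitions (Semiring.rawSemiring semiring) using (_^_)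
  open SemiringMult semiring using (×-congʳ; ×-assoc-*) renaming (_×_ to _×′_)
  open SemiringSum semiring using (sum; sum-cong-≋; ∑-distrib-+; *-distribˡ-sum; sum-replicate)
  open SemiringSolver commutativeSemiring using (solve; _:=_; _:+_; _:*_)
  open Matrices commutativeRing
  open Determinants commutativeRing using (sum-zero)
  open MatrixProperties commutativeRing
  open OrderedFieldProperties K
  open SumsOfSquares K
  open CharacteristicPolynomials K using (powerSum; trace-power-spectrum; I-diagonal)
  open Walks commutativeRing
  open FibreSums commutativeRing
  open SetoidReasoning setoid

  X : Graph (n ℕ.* r)
  X = cover f

  ρ : Carrier
  ρ = r ×′ 1#

  sum-const : ∀ x → sum {r} (λ _ → x) ≈ ρ * x
  sum-const x = trans (sum-replicate r) (sym (trans (×-assoc-* r 1# x) (×-congʳ r (*-identityˡ x))))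

  B : ℕ → Matrix (n ℕ.* r)
  B = power (adjacency X)

  L : ℕ → Matrix (n ℕ.* r)
  L k x y = power (adjacency Y) k (fibre f x) (fibre f y)

  -- V k = B k (ρ I - J), where J x y is 1 if x and y lie in the same fibre and 0
  -- otherwise; ρ I - J is ρ times the projection onto the
  -- orthogonal complement of the vectors that are constant on fibres.
  V : ℕ → Matrix (n ℕ.* r)
  V k x y = ρ * B k x y + - 1# * L k x y

  -- The columns of `L k` are constant on fibres.
  A·L : ∀ k x z → (adjacency X · L k) x z ≈ L (suc k) x z
  A·L k x z = cover-row f x (λ u → power (adjacency Y) k u (fibre f z))

  B·L : ∀ j k x z → (B j · L k) x z ≈ L (j ℕ.+ k) x z
  B·L zero    k x z = sum-Iˡ (λ y → L k y z) x
  B·L (suc j) k x z = begin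
    ((adjacency X · B j) · L k) x z ≈⟨ ·-assoc (adjacency X) (B j) (L k) x z ⟩
    (adjacency X · (B j · L k)) x z ≈⟨ ·-cong {A = adjacency X} (λ _ _ → refl) (B·L j k) x z ⟩
    (adjacency X · L (j ℕ.+ k)) x z ≈⟨ A·L (j ℕ.+ k) x z ⟩
    L (suc j ℕ.+ k) x z             ∎

  -- Every intermediate vertex of the base is counted once for each of the `r` points above it.
  L·L : ∀ j k x z → (L j · L k) x z ≈ ρ * L (j ℕ.+ k) x z
  L·L j k x z = begin
    (L j · L k) x z
      ≈⟨ sum-remQuot n r (λ (u , _) → P j (fibre f x) u * P k u (fibre f z)) ⟩
    sum (λ u → sum {r} (λ _ → P j (fibre f x) u * P k u (fibre f z)))
      ≈⟨ sum-cong-≋ (λ u → sum-const (P j (fibre f x) u * P k u (fibre f z))) ⟩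
    sum (λ u → ρ * (P j (fibre f x) u * P k u (fibre f z)))
      ≈⟨ *-distribˡ-sum ρ (λ u → P j (fibre f x) u * P k u (fibre f z)) ⟨
    ρ * (P j · P k) (fibre f x) (fibre f z)
      ≈⟨ *-congˡ (power-+ (adjacency Y) j k _ _) ⟨
    ρ * L (j ℕ.+ k) x z ∎
    where
    P : ℕ → Matrix n
    P = power (adjacency Y)

  B-sym : ∀ k x y → B k x y ≈ B k y x
  B-sym = power-sym (adjacency X) (adjacency-sym X)

  L-sym : ∀ k x y → L k x y ≈ L k y x
  L-sym k x y = power-sym (adjacency Y) (adjacency-sym Y) k _ _

  V-sym : ∀ k x y → V k x y ≈ V k y x
  V-sym k x y = +-cong (*-congˡ (B-sym k x y)) (*-congˡ (L-sym k x y))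

  -- The transpose of `B·L`, as all these matrices are symmetric.
  L·B : ∀ j k x z → (L j · B k) x z ≈ L (j ℕ.+ k) x z
  L·B j k x z = begin
    (L j · B k) x z    ≈⟨ sum-cong-≋ (λ y → trans (*-cong (L-sym j x y) (B-sym k y z)) (*-comm _ _)) ⟩
    (B k · L j) z x    ≈⟨ B·L k j z x ⟩
    L (k ℕ.+ j) z x    ≈⟨ L-sym (k ℕ.+ j) z x ⟩
    L (k ℕ.+ j) x z    ≈⟨ reflexive (≡.cong (λ m → L m x z) (ℕₚ.+-comm k j)) ⟩
    L (j ℕ.+ k) x z    ∎

  sum-linear : ∀ {m} a b (g h : Vector Carrier m) → sum (λ i → a * g i + b * h i) ≈ a * sum g + b * sum h
  sum-linear a b g h = trans (∑-distrib-+ (λ i → a * g i) (λ i → b * h i))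
    (+-cong (sym (*-distribˡ-sum a g)) (sym (*-distribˡ-sum b h)))

  M·V : ∀ (M : Matrix (n ℕ.* r)) k x z → (M · V k) x z ≈ ρ * (M · B k) x z + - 1# * (M · L k) x z
  M·V M k x z = trans
    (sum-cong-≋ (λ y → solve 5 (λ a p b q l → a :* (p :* b :+ q :* l) := p :* (a :* b) :+ q :* (a :* l))
      refl (M x y) ρ (B k y z) (- 1#) (L k y z)))
    (sum-linear ρ (- 1#) (λ y → M x y * B k y z) (λ y → M x y * L k y z))

  x-1*x≈0 : ∀ x → x + - 1# * x ≈ 0#
  x-1*x≈0 x = trans (+-congˡ (-1*x≈-x x)) (-‿inverseʳ x)

  A·V : ∀ k x z → (adjacency X · V k) x z ≈ V (suc k) x z
  A·V k x z = trans (M·V (adjacency X) k x z) (+-congˡ (*-congˡ (A·L k x z)))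

  B·V : ∀ j k x z → (B j · V k) x z ≈ V (j ℕ.+ k) x z
  B·V j k x z = trans (M·V (B j) k x z)
    (+-cong (*-congˡ (sym (power-+ (adjacency X) j k x z))) (*-congˡ (B·L j k x z)))

  -- Both parts of `V k` contribute `ρ * L (j ℕ.+ k)`, with opposite signs.
  L·V : ∀ j k x z → (L j · V k) x z ≈ 0#
  L·V j k x z = begin
    (L j · V k) x z                                   ≈⟨ M·V (L j) k x z ⟩
    ρ * (L j · B k) x z + - 1# * (L j · L k) x z      ≈⟨ +-cong (*-congˡ (L·B j k x z)) (*-congˡ (L·L j k x z)) ⟩
    ρ * L (j ℕ.+ k) x z + - 1# * (ρ * L (j ℕ.+ k) x z) ≈⟨ x-1*x≈0 _ ⟩
    0#                                                ∎

  -- Only the left factor is expanded; its `L` part is annihilated by `L·V`.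
  V·V : ∀ j k x z → (V j · V k) x z ≈ ρ * V (j ℕ.+ k) x z
  V·V j k x z = begin
    (V j · V k) x z
      ≈⟨ sum-cong-≋ (λ y → solve 5 (λ p b q l v → (p :* b :+ q :* l) :* v := p :* (b :* v) :+ q :* (l :* v))
           refl ρ (B j x y) (- 1#) (L j x y) (V k y z)) ⟩
    sum (λ y → ρ * (B j x y * V k y z) + - 1# * (L j x y * V k y z))
      ≈⟨ sum-linear ρ (- 1#) (λ y → B j x y * V k y z) (λ y → L j x y * V k y z) ⟩
    ρ * (B j · V k) x z + - 1# * (L j · V k) x z
      ≈⟨ +-cong (*-congˡ (B·V j k x z)) (trans (*-congˡ (L·V j k x z)) (zeroʳ _)) ⟩
    ρ * V (j ℕ.+ k) x z + 0#
      ≈⟨ +-identityʳ _ ⟩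
    ρ * V (j ℕ.+ k) x z ∎

  trace-L : ∀ k → trace (L k) ≈ ρ * trace (power (adjacency Y) k)
  trace-L k = begin
    trace (L k) ≈⟨ sum-remQuot n r (λ (u , _) → power (adjacency Y) k u u) ⟩
    sum (λ u → sum {r} (λ _ → power (adjacency Y) k u u)) ≈⟨ sum-cong-≋ (λ u → sum-const (power (adjacency Y) k u u)) ⟩
    sum (λ u → ρ * power (adjacency Y) k u u) ≈⟨ *-distribˡ-sum ρ (λ u → power (adjacency Y) k u u) ⟨
    ρ * trace (power (adjacency Y) k) ∎

  -- `p` is the excess of the trace for the cover over that for the base, later a power sum of the
  -- new eigenvalues.
  trace-V : ∀ k {p} → trace (B k) ≈ trace (power (adjacency Y) k) + p → trace (V k) ≈ ρ * p
  trace-V k {p} trB = begin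
    trace (V k)
      ≈⟨ sum-linear ρ (- 1#) (λ x → B k x x) (λ x → L k x x) ⟩
    ρ * trace (B k) + - 1# * trace (L k)
      ≈⟨ +-cong (*-congˡ trB) (*-congˡ (trace-L k)) ⟩
    ρ * (trA + p) + - 1# * (ρ * trA)
      ≈⟨ solve 4 (λ q a p m → q :* (a :+ p) :+ m :* (q :* a) := (q :* a :+ m :* (q :* a)) :+ q :* p) refl ρ trA p (- 1#) ⟩
    (ρ * trA + - 1# * (ρ * trA)) + ρ * p
      ≈⟨ trans (+-congʳ (x-1*x≈0 _)) (+-identityˡ _) ⟩
    ρ * p ∎
    where
    trA : Carrier
    trA = trace (power (adjacency Y) k)

  -- The quadratic relation for `V` and walk regularity of the cover.

  module _ (sX sY d : List Carrier)
    (spectrumX : Spectra.IsSpectrum K (adjacency X) sX)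
    (spectrumY : Spectra.IsSpectrum K (adjacency Y) sY)
    (powerSum-split : ∀ k → powerSum k sX ≈ powerSum k sY + powerSum k d)
    (θ τ : Carrier) (two : All (λ x → x ≈ θ ⊎ x ≈ τ) d) where

    -- The polynomial `(x - θ)(x - τ)` with each power of `x` replaced by a term of a sequence.
    -- Being linear in the sequence, it commutes with scalars, sums and traces.
    quadratic : (ℕ → Carrier) → Carrier
    quadratic s = s 2 + (- (θ + τ) * s 1 + (θ * τ) * s 0)

    quadratic-cong : ∀ {s s′} → (∀ i → s i ≈ s′ i) → quadratic s ≈ quadratic s′
    quadratic-cong s≈ = +-cong (s≈ 2) (+-cong (*-congˡ (s≈ 1)) (*-congˡ (s≈ 0)))

    quadratic-scale : ∀ a s → quadratic (λ i → a * s i) ≈ a * quadratic s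
    quadratic-scale a s = solve 6 (λ a s2 p s1 q s0 → a :* s2 :+ (p :* (a :* s1) :+ q :* (a :* s0)) := a :* (s2 :+ (p :* s1 :+ q :* s0)))
      refl a (s 2) (- (θ + τ)) (s 1) (θ * τ) (s 0)

    quadratic-+ : ∀ s s′ → quadratic (λ i → s i + s′ i) ≈ quadratic s + quadratic s′
    quadratic-+ s s′ = solve 8 (λ s2 t2 p s1 t1 q s0 t0 →
        (s2 :+ t2) :+ (p :* (s1 :+ t1) :+ q :* (s0 :+ t0)) := (s2 :+ (p :* s1 :+ q :* s0)) :+ (t2 :+ (p :* t1 :+ q :* t0)))
      refl (s 2) (s′ 2) (- (θ + τ)) (s 1) (s′ 1) (θ * τ) (s 0) (s′ 0)

    quadratic-0 : quadratic (λ _ → 0#) ≈ 0#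
    quadratic-0 = trans (quadratic-cong {s′ = λ _ → 0# * 0#} (λ _ → sym (zeroˡ 0#))) (trans (quadratic-scale 0# (λ _ → 0#)) (zeroˡ _))

    quadratic-zero : ∀ {s} → (∀ i → s i ≈ 0#) → quadratic s ≈ 0#
    quadratic-zero s≈0 = trans (quadratic-cong s≈0) quadratic-0

    quadratic-sum : ∀ {m} (s : Fin m → ℕ → Carrier) →
      quadratic (λ i → sum (λ x → s x i)) ≈ sum (λ x → quadratic (s x))
    quadratic-sum {zero}  s = quadratic-0
    quadratic-sum {suc m} s = trans (quadratic-+ (s zero) (λ i → sum (λ x → s (suc x) i))) (+-congˡ (quadratic-sum (s ∘ suc)))

    quadratic-root : ∀ x → x ≈ θ ⊎ x ≈ τ → x * x + (- (θ + τ) * x + θ * τ) ≈ 0#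
    quadratic-root x (inj₁ x≈θ) = begin
      x * x + (- (θ + τ) * x + θ * τ) ≈⟨ +-cong (*-cong x≈θ x≈θ) (+-congʳ (*-congˡ x≈θ)) ⟩
      θ * θ + (- (θ + τ) * θ + θ * τ) ≈⟨ solve 3 (λ a b m → a :* a :+ (m :* a :+ a :* b) := (a :+ b :+ m) :* a) refl θ τ (- (θ + τ)) ⟩
      (θ + τ - (θ + τ)) * θ           ≈⟨ trans (*-congʳ (-‿inverseʳ _)) (zeroˡ θ) ⟩
      0#                              ∎
    quadratic-root x (inj₂ x≈τ) = begin
      x * x + (- (θ + τ) * x + θ * τ) ≈⟨ +-cong (*-cong x≈τ x≈τ) (+-congʳ (*-congˡ x≈τ)) ⟩
      τ * τ + (- (θ + τ) * τ + θ * τ) ≈⟨ solve 3 (λ a b m → b :* b :+ (m :* b :+ a :* b) := (a :+ b :+ m) :* b) refl θ τ (- (θ + τ)) ⟩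
      (θ + τ - (θ + τ)) * τ           ≈⟨ trans (*-congʳ (-‿inverseʳ _)) (zeroˡ τ) ⟩
      0#                              ∎

    -- Each `x` in the list contributes `(x - θ)(x - τ)` times its `k`-th power.
    quadratic-powerSum : ∀ k {s} → All (λ x → x ≈ θ ⊎ x ≈ τ) s → quadratic (λ i → powerSum (i ℕ.+ k) s) ≈ 0#
    quadratic-powerSum k [] = quadratic-0
    quadratic-powerSum k {x ∷ s} (root ∷ roots) = begin
      quadratic (λ i → x ^ (i ℕ.+ k) + powerSum (i ℕ.+ k) s)
        ≈⟨ quadratic-+ (λ i → x ^ (i ℕ.+ k)) (λ i → powerSum (i ℕ.+ k) s) ⟩
      quadratic (λ i → x ^ (i ℕ.+ k)) + quadratic (λ i → powerSum (i ℕ.+ k) s)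
        ≈⟨ +-cong quadratic-^ (quadratic-powerSum k roots) ⟩
      0# + 0# ≈⟨ +-identityˡ 0# ⟩
      0# ∎
      where
      quadratic-^ : quadratic (λ i → x ^ (i ℕ.+ k)) ≈ 0#
      quadratic-^ = begin
        x * (x * (x ^ k)) + (- (θ + τ) * (x * (x ^ k)) + (θ * τ) * (x ^ k))
          ≈⟨ solve 4 (λ x m q y → x :* (x :* y) :+ (m :* (x :* y) :+ q :* y) := (x :* x :+ (m :* x :+ q)) :* y)
               refl x (- (θ + τ)) (θ * τ) (x ^ k) ⟩
        (x * x + (- (θ + τ) * x + θ * τ)) * (x ^ k) ≈⟨ *-congʳ (quadratic-root x root) ⟩
        0# * (x ^ k) ≈⟨ zeroˡ _ ⟩
        0# ∎

    N : Matrix (n ℕ.* r)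
    N x y = quadratic (λ i → V i x y)

    trace-V≈ : ∀ k → trace (V k) ≈ ρ * powerSum k d
    trace-V≈ k = trace-V k (begin
      trace (B k)                 ≈⟨ trace-power-spectrum (adjacency X) sX spectrumX k ⟩
      powerSum k sX               ≈⟨ powerSum-split k ⟩
      powerSum k sY + powerSum k d ≈⟨ +-congʳ (trace-power-spectrum (adjacency Y) sY spectrumY k) ⟨
      trace (power (adjacency Y) k) + powerSum k d ∎)

    -- `V·V` turns the product into shifted `V`s, whose traces are multiples of the power sums of
    -- `d`.
    trace-N·V : ∀ k → trace (N · V k) ≈ 0#
    trace-N·V k = begin
      trace (N · V k)
        ≈⟨ sum-cong-≋ (λ x → begin
             (N · V k) x x
               ≈⟨ sum-cong-≋ (λ y → begin
                    N x y * V k y x ≈⟨ *-comm _ _ ⟩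
                    V k y x * N x y ≈⟨ quadratic-scale (V k y x) (λ i → V i x y) ⟨
                    quadratic (λ i → V k y x * V i x y) ≈⟨ quadratic-cong (λ i → *-comm (V k y x) (V i x y)) ⟩
                    quadratic (λ i → V i x y * V k y x) ∎) ⟩
             sum (λ y → quadratic (λ i → V i x y * V k y x)) ≈⟨ quadratic-sum (λ y i → V i x y * V k y x) ⟨
             quadratic (λ i → (V i · V k) x x) ≈⟨ quadratic-cong (λ i → V·V i k x x) ⟩
             quadratic (λ i → ρ * V (i ℕ.+ k) x x) ≈⟨ quadratic-scale ρ (λ i → V (i ℕ.+ k) x x) ⟩
             ρ * quadratic (λ i → V (i ℕ.+ k) x x) ∎) ⟩
      sum (λ x → ρ * quadratic (λ i → V (i ℕ.+ k) x x))
        ≈⟨ *-distribˡ-sum ρ (λ x → quadratic (λ i → V (i ℕ.+ k) x x)) ⟨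
      ρ * sum (λ x → quadratic (λ i → V (i ℕ.+ k) x x))
        ≈⟨ *-congˡ (quadratic-sum (λ x i → V (i ℕ.+ k) x x)) ⟨
      ρ * quadratic (λ i → trace (V (i ℕ.+ k)))
        ≈⟨ *-congˡ (trans (quadratic-cong (λ i → trace-V≈ (i ℕ.+ k))) (quadratic-scale ρ (λ i → powerSum (i ℕ.+ k) d))) ⟩
      ρ * (ρ * quadratic (λ i → powerSum (i ℕ.+ k) d))
        ≈⟨ *-congˡ (trans (*-congˡ (quadratic-powerSum k two)) (zeroʳ ρ)) ⟩
      ρ * 0# ≈⟨ zeroʳ ρ ⟩
      0# ∎

    -- By symmetry the sum of the squared entries is the trace of `N · N`, a combination of the
    -- vanishing traces of `N · V i`.
    N≈0 : ∀ x y → N x y ≈ 0#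
    N≈0 = sum-squares-zero N (begin
      sum (λ x → sum (λ y → N x y * N x y))
        ≈⟨ sum-cong-≋ (λ x → sum-cong-≋ (λ y → trans (*-congˡ (quadratic-cong (λ i → V-sym i x y)))
             (sym (quadratic-scale (N x y) (λ i → V i y x))))) ⟩
      sum (λ x → sum (λ y → quadratic (λ i → N x y * V i y x)))
        ≈⟨ sum-cong-≋ (λ x → quadratic-sum (λ y i → N x y * V i y x)) ⟨
      sum (λ x → quadratic (λ i → (N · V i) x x))
        ≈⟨ quadratic-sum (λ x i → (N · V i) x x) ⟨
      quadratic (λ i → trace (N · V i))
        ≈⟨ quadratic-zero trace-N·V ⟩
      0# ∎)

    -- The relation `N = 0` is multiplied repeatedly by the adjacency matrix of the cover.
    V-recurrence : ∀ k x y → quadratic (λ i → V (i ℕ.+ k) x y) ≈ 0#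
    V-recurrence zero    x y = N≈0 x y
    V-recurrence (suc k) x y = begin
      quadratic (λ i → V (i ℕ.+ suc k) x y)
        ≈⟨ quadratic-cong (λ i → trans (reflexive (≡.cong (λ m → V m x y) (ℕₚ.+-suc i k))) (sym (A·V (i ℕ.+ k) x y))) ⟩
      quadratic (λ i → (adjacency X · V (i ℕ.+ k)) x y)
        ≈⟨ quadratic-sum (λ z i → adjacency X x z * V (i ℕ.+ k) z y) ⟩
      sum (λ z → quadratic (λ i → adjacency X x z * V (i ℕ.+ k) z y))
        ≈⟨ sum-zero (λ z → trans (quadratic-scale (adjacency X x z) (λ i → V (i ℕ.+ k) z y))
             (trans (*-congˡ (V-recurrence k z y)) (zeroʳ _))) ⟩
      0# ∎

    -- The initial values are constant because identity matrices have diagonal 1 and graphs have no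
    -- loops; the recurrence does the rest.
    V-diagonal-constant : ∀ k x y → V k x x ≈ V k y y
    V-diagonal-constant zero x y = +-cong
      (*-congˡ (reflexive (≡.trans (I-diagonal x) (≡.sym (I-diagonal y)))))
      (*-congˡ (reflexive (≡.trans (I-diagonal (fibre f x)) (≡.sym (I-diagonal (fibre f y))))))
    V-diagonal-constant (suc zero) x y = +-cong
      (*-congˡ (trans (diagonal-0 X x) (sym (diagonal-0 X y))))
      (*-congˡ (trans (diagonal-0 Y (fibre f x)) (sym (diagonal-0 Y (fibre f y)))))
      where
      diagonal-0 : ∀ {m} (Z : Graph m) z → power (adjacency Z) 1 z z ≈ 0#
      diagonal-0 Z z = trans (power-1 (adjacency Z) z z) (adjacency-diagonal Z z)
    V-diagonal-constant (suc (suc k)) x y = +-cancelʳ _ _ _ (begin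
      V (2 ℕ.+ k) x x + (- (θ + τ) * V (suc k) x x + (θ * τ) * V k x x) ≈⟨ V-recurrence k x x ⟩
      0#                                                                ≈⟨ V-recurrence k y y ⟨
      V (2 ℕ.+ k) y y + (- (θ + τ) * V (suc k) y y + (θ * τ) * V k y y)
        ≈⟨ +-congˡ (+-cong (*-congˡ (V-diagonal-constant (suc k) x y)) (*-congˡ (V-diagonal-constant k x y))) ⟨
      V (2 ℕ.+ k) y y + (- (θ + τ) * V (suc k) x x + (θ * τ) * V k x x) ∎)

    -- The argument of type `Fin r` excludes `r = 0`.
    ρ#0 : Fin r → ρ # 0#
    ρ#0 = positive r
      where
      positive : ∀ r → Fin r → (r ×′ 1#) # 0#
      positive (suc r) _ = <⇒# (0<1+n r)

    cover-walkRegular : WalkRegular Y → WalkRegular X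
    cover-walkRegular regular = walks-walkRegular X λ k 1≤k x y →
      -- Equality is obtained in the field and pulled back to walk counts.
      ×1-injective _ _ (trans (sym (power-adjacency X k x x)) (trans (B-diagonal k 1≤k x y) (power-adjacency X k y y)))
      where
      L-diagonal : ∀ k → 1 ℕ.≤ k → ∀ x y → L k x x ≈ L k y y
      L-diagonal k 1≤k x y = begin
        L k x x ≈⟨ power-adjacency Y k _ _ ⟩
        walks Y k (fibre f x) (fibre f x) ×′ 1#
          ≈⟨ reflexive (≡.cong (_×′ 1#) (walkRegular-walks Y regular k 1≤k (fibre f x) (fibre f y))) ⟩
        walks Y k (fibre f y) (fibre f y) ×′ 1# ≈⟨ power-adjacency Y k _ _ ⟨
        L k y y ∎
      B-diagonal : ∀ k → 1 ℕ.≤ k → ∀ x y → B k x x ≈ B k y y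
      -- `ρ * B k` is `V k` plus `L k`, both constant on the diagonal; the vertex `x` supplies the
      -- element of `Fin r` that lets `ρ` be cancelled.
      B-diagonal k 1≤k x y = *-cancelˡ-#0 (ρ#0 (proj₂ (remQuot {n} r x)))
        (+-cancelʳ _ _ _ (trans (V-diagonal-constant k x y) (+-congˡ (*-congˡ (sym (L-diagonal k 1≤k x y))))))

-- Power sums of the new eigenvalues and the conclusion.

corollary5p2 : ∀ {c ℓ₁ ℓ₂ ℓ₃ : Level.Level} (K : OrderedField c ℓ₁ ℓ₂ ℓ₃)
    {n r : ℕ} (Y : Graph n) → Connected Y →
    (G : PermutationGroup r) (f : SymmetricArcFunction Y G) →
    Normalized f → Regular ⟨ f ⟩ → Abelian ⟨ f ⟩ →
    Spectra.Is2evCover K f →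
    WalkRegular Y → WalkRegular (cover f)
corollary5p2 K Y _ G f _ _ _ (sX , sY , d , spectrumX , spectrumY , sX↭sY++d , θ , τ , _ , _ , _ , two) =
  TwoEigenvalueCovers.cover-walkRegular K f sX sY d spectrumX spectrumY split θ τ two
  where
  open CommutativeRing (OrderedField.commutativeRing K)
  open CharacteristicPolynomials K using (powerSum)
  open PermutationProperties setoid using (foldr-commMonoid; map⁺)
  open RawSemiringDefinitions (Semiring.rawSemiring semiring) using (_^_)
  powerSum-++ : ∀ k s s′ → powerSum k (s ++ s′) ≈ powerSum k s + powerSum k s′
  powerSum-++ k []      s′ = sym (+-identityˡ _)
  powerSum-++ k (x ∷ s) s′ = trans (+-congˡ (powerSum-++ k s s′)) (sym (+-assoc _ _ _))
  split : ∀ k → powerSum k sX ≈ powerSum k sY + powerSum k d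
  split k = trans
    -- A power sum is a fold in a commutative monoid, hence invariant under the reordering
    -- `sX↭sY++d`.
    (foldr-commMonoid +-isCommutativeMonoid (map⁺ setoid (^-cong k) sX↭sY++d))
    (powerSum-++ k sY d)
    where
    ^-cong : ∀ k {x y} → x ≈ y → x ^ k ≈ y ^ k
    ^-cong zero    x≈y = refl
    ^-cong (suc k) x≈y = *-cong x≈y (^-cong k x≈y)
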